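{- There is a constant $C>0$ such that for every positive integer $k$ and every $k$-permutation $\pi$, $$c(\pi)\le 2^{Ck}\qquad\text{and}\qquad L(\pi)\le 2^{Ck}.$$
   Context: Write $[n]=\{1,\dots,n\}$. An $n$-permutation is a permutation of $[n]$. An $n$-permutation $\sigma$ contains a $k$-permutation $\pi$ if there are integers $1\le x_1<\dots<x_k\le n$ such that for all $1\le i,j\le k$ we have $\sigma(x_i)<\sigma(x_j)$ if and only if $\pi(i)<\pi(j)$; otherwise $\sigma$ avoids $\pi$. $S_n(\pi)$ is the number of $n$-permutations avoiding $\pi$, and $L(\pi)=\lim_{n\to\infty}S_n(\pi)^{1/n}$ (known to exist and be finite). All matrices are binary (entries in $\{0,1\}$). A matrix $A$ contains a $k\times\ell$ matrix $P=(p_{ij})$ if $A$ has a $k\times\ell$ submatrix $D=(d_{ij})$ (choose $k$ rows and $\ell$ columns, keeping their order) with $d_{ij}=1$ whenever $p_{ij}=1$; otherwise $A$ avoids $P$. The mass of a matrix is the number of its one-entries. For a permutation $\pi$ with permutation matrix $P$ (ones exactly at the positions $(i,\pi(i))$), $\mathrm{ex}(n,\pi)$ is the maximum mass of an $n\times n$ matrix that avoids $P$. The Füredi-Hajnal limit is $c(\pi)=\lim_{n\to\infty}\mathrm{ex}(n,\pi)/n$ (known to exist and be finite). -}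

module Defs where

open import Data.Bool.Base using (Bool; true; false)
import Data.Bool.Properties as Bool
open import Data.Fin.Base as Fin using (Fin; zero; suc; punchIn)
import Data.Fin.Properties as Fin
open import Data.Fin.Permutation as Perm
  using (Permutation′; _⟨$⟩ʳ_; insert; remove; insert-remove)
open import Data.Integer.Base using (+_)
open import Data.List.Base
  using (List; []; _∷_; allFin; cartesianProductWith; filter; length; map)
open import Data.List.Extrema.Nat using (max; xs≤max; argmax-sel)
open import Data.List.Membership.Propositional using (_∈_; find; lose)
open import Data.List.Membership.Propositional.Properties
  using (∈-allFin; ∈-cartesianProductWith⁺; ∈-filter⁺; ∈-filter⁻; ∈-map⁺; ∈-map⁻)
import Data.List.Membership.Setoid.Properties as Memₛ
open import Data.List.Relation.Unary.All as All using ([])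
open import Data.List.Relation.Unary.AllPairs using ([]; _∷_)
open import Data.List.Relation.Unary.Any using (here; there; any?)
open import Data.List.Relation.Unary.Enumerates.Setoid using (IsEnumeration)
open import Data.List.Relation.Unary.Unique.Setoid using (Unique)
import Data.List.Relation.Unary.Unique.Propositional.Properties as Uniqueₚ
import Data.List.Relation.Unary.Unique.Setoid.Properties as Unique
open import Data.Nat.Base as ℕ using (ℕ; zero; suc; NonZero)
open import Data.Product.Base using (_×_; _,_; proj₂; ∃; ∃-syntax)
open import Data.Rational.Base
  using ( ℚ; 0ℚ; 1ℚ; _+_; _-_; _*_; -_; _⊓_; _⊔_; _<_; _≤_; _/_; 1/_
        ; positive; nonNegative; +-*-rawSemiring)
open import Data.Rational.Properties
open import Data.Sum.Base using (_⊎_; inj₁; inj₂)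
open import Data.Vec.Base as Vec
  using (Vec; []; _∷_; lookup; tabulate; replicate; count; sum)
open import Data.Vec.Properties using (lookup-replicate; lookup∘tabulate)
open import Function.Base using (id)
open import Function.Bundles using (_⇔_; mk⇔; Equivalence)
open import Level using (0ℓ)
open import Relation.Binary.Bundles using (Setoid)
open import Relation.Binary.PropositionalEquality
  using (_≡_; refl; sym; trans; cong; cong₂; subst; setoid)
open import Relation.Nullary using (¬_; Dec; yes; no; does; contradiction)
open import Relation.Nullary.Decidable using (map′; _×-dec_; _→-dec_; ¬?; dec-true)
open import Relation.Unary using (Pred; Decidable)

open import Algebra.Definitions.RawSemiring +-*-rawSemiring using (_^_)

private
  variable
    k l m n : ℕ

vectors : ∀ {A : Set} → List A → ∀ n → List (Vec A n)
vectors xs zero    = [] ∷ []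
vectors xs (suc n) = cartesianProductWith _∷_ xs (vectors xs n)

∈-vectors : ∀ {A : Set} {xs : List A} → (∀ x → x ∈ xs) → (v : Vec A n) → v ∈ vectors xs n
∈-vectors all []      = here refl
∈-vectors all (x ∷ v) = ∈-cartesianProductWith⁺ _∷_ (all x) (∈-vectors all v)

anyPositions? : ∀ {P : Pred (Vec (Fin n) k) 0ℓ} → Decidable P → Dec (∃ P)
anyPositions? {n} {k} P? =
  map′ (λ p → let v , _ , Pv = find p in v , Pv)
       (λ (v , Pv) → lose (∈-vectors ∈-allFin v) Pv)
       (any? P? (vectors (allFin n) k))

Increasing : Vec (Fin n) k → Set
Increasing x = ∀ i j → i Fin.< j → lookup x i Fin.< lookup x j

increasing? : Decidable (Increasing {n} {k})
increasing? x = Fin.all? λ i → Fin.all? λ j →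
  (i Fin.<? j) →-dec (lookup x i Fin.<? lookup x j)

_Occurs-in_At_ : Permutation′ k → Permutation′ n → Vec (Fin n) k → Set
π Occurs-in σ At x = ∀ i j →
  (σ ⟨$⟩ʳ lookup x i Fin.< σ ⟨$⟩ʳ lookup x j) ⇔ (π ⟨$⟩ʳ i Fin.< π ⟨$⟩ʳ j)

_Contains_ : Permutation′ n → Permutation′ k → Set
_Contains_ {n} {k} σ π = ∃[ x ] Increasing {n} {k} x × π Occurs-in σ At x

_Avoids_ : Permutation′ n → Permutation′ k → Set
σ Avoids π = ¬ (σ Contains π)

avoids? : (π : Permutation′ k) → Decidable {A = Permutation′ n} (_Avoids π)
avoids? π σ = ¬? (anyPositions? λ x → increasing? x ×-dec
  (Fin.all? λ i → Fin.all? λ j →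
    (σ ⟨$⟩ʳ lookup x i Fin.<? σ ⟨$⟩ʳ lookup x j) ⇔-dec (π ⟨$⟩ʳ i Fin.<? π ⟨$⟩ʳ j)))
  where
  _⇔-dec_ : {A B : Set} → Dec A → Dec B → Dec (A ⇔ B)
  a ⇔-dec b = map′ (λ (f , g) → mk⇔ f g)
                   (λ e → Equivalence.to e , Equivalence.from e)
                   ((a →-dec b) ×-dec (b →-dec a))

permutations : ∀ n → List (Permutation′ n)
permutations zero    = Perm.id ∷ []
permutations (suc n) = cartesianProductWith (insert zero) (allFin (suc n)) (permutations n)

-- `permutations n` lists every permutation of `Fin n` exactly once, up to
-- pointwise equality, so that its sublists count permutations correctly.

permutationSetoid : ℕ → Setoid 0ℓ 0ℓ
permutationSetoid n = record
  { Carrier       = Permutation′ n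
  ; _≈_           = Perm._≈_
  ; isEquivalence = record
    { refl  = λ _ → refl
    ; sym   = λ p i → sym (p i)
    ; trans = λ p q i → trans (p i) (q i)
    }
  }

private
  insert-cong : ∀ {j j′} {π ρ : Permutation′ n} →
    j ≡ j′ → π Perm.≈ ρ → insert zero j π Perm.≈ insert zero j′ ρ
  insert-cong refl π≈ρ zero        = refl
  insert-cong {j = j} refl π≈ρ (suc i) = cong (punchIn j) (π≈ρ i)

  insert-injective : ∀ {j j′} {π ρ : Permutation′ n} →
    insert zero j π Perm.≈ insert zero j′ ρ → j ≡ j′ × π Perm.≈ ρ
  insert-injective {j = j} {π = π} {ρ} eq with refl ← eq zero =
    refl , λ i → Fin.punchIn-injective j _ _ (eq (suc i))

permutations-complete : ∀ n → IsEnumeration (permutationSetoid n) (permutations n)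
permutations-complete zero    π = here λ ()
permutations-complete (suc n) π =
  Memₛ.∈-resp-≈ (permutationSetoid (suc n))
    {x = insert zero (π ⟨$⟩ʳ zero) (remove zero π)} {π} (insert-remove zero π)
    (Memₛ.∈-cartesianProductWith⁺ (setoid (Fin (suc n))) (permutationSetoid n)
      (permutationSetoid (suc n))
      (λ {_} {_} {ρ} {τ} → insert-cong {π = ρ} {τ})
      (∈-allFin (π ⟨$⟩ʳ zero))
      (permutations-complete n (remove zero π)))

permutations-unique : ∀ n → Unique (permutationSetoid n) (permutations n)
permutations-unique zero    = [] ∷ []
permutations-unique (suc n) =
  Unique.cartesianProductWith⁺ (setoid (Fin (suc n))) (permutationSetoid n)
    (permutationSetoid (suc n)) (insert zero)
    (λ {_} {_} {π} {ρ} → insert-injective {π = π} {ρ})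
    (Uniqueₚ.allFin⁺ (suc n)) (permutations-unique n)

S : ℕ → Permutation′ k → ℕ
S n π = length (filter (avoids? π) (permutations n))

Matrix : ℕ → ℕ → Set
Matrix m n = Vec (Vec Bool n) m

entry : Matrix m n → Fin m → Fin n → Bool
entry A i j = lookup (lookup A i) j

_Covers_At_,_ : Matrix m n → Matrix k l → Vec (Fin m) k → Vec (Fin n) l → Set
A Covers P At r , c = ∀ i j →
  entry P i j ≡ true → entry A (lookup r i) (lookup c j) ≡ true

_Containsᴹ_ : Matrix m n → Matrix k l → Set
_Containsᴹ_ {m} {n} {k} {l} A P = ∃[ r ] ∃[ c ]
  Increasing {m} {k} r × Increasing {n} {l} c × A Covers P At r , c

_Avoidsᴹ_ : Matrix m n → Matrix k l → Set
A Avoidsᴹ P = ¬ (A Containsᴹ P)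

avoidsᴹ? : (P : Matrix k l) → Decidable {A = Matrix m n} (_Avoidsᴹ P)
avoidsᴹ? P A = ¬? (anyPositions? λ r → anyPositions? λ c →
  increasing? r ×-dec increasing? c ×-dec
  (Fin.all? λ i → Fin.all? λ j →
    (entry P i j Bool.≟ true) →-dec
    (entry A (lookup r i) (lookup c j) Bool.≟ true)))

mass : Matrix m n → ℕ
mass A = sum (Vec.map (count (Bool._≟ true)) A)

matrices : ∀ m n → List (Matrix m n)
matrices m n = vectors (vectors (false ∷ true ∷ []) n) m

∈-matrices : (A : Matrix m n) → A ∈ matrices m n
∈-matrices = ∈-vectors (∈-vectors λ { false → here refl ; true → there (here refl) })

permutationMatrix : Permutation′ k → Matrix k k
permutationMatrix π = tabulate λ i → tabulate λ j → does (π ⟨$⟩ʳ i Fin.≟ j)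

ex : ℕ → Permutation′ k → ℕ
ex n π = max 0 (map mass (filter (avoidsᴹ? (permutationMatrix π)) (matrices n n)))

ex-upper : ∀ n (π : Permutation′ k) (A : Matrix n n) →
  A Avoidsᴹ permutationMatrix π → mass A ℕ.≤ ex n π
ex-upper n π A avoids = All.lookup (xs≤max 0 _)
  (∈-map⁺ mass (∈-filter⁺ (avoidsᴹ? (permutationMatrix π)) (∈-matrices A) avoids))

private
  zeros : ∀ m n → Matrix m n
  zeros m n = replicate m (replicate n false)

  mass-zeros : ∀ m n → mass (zeros m n) ≡ 0
  mass-zeros zero    n = refl
  mass-zeros (suc m) n = cong₂ ℕ._+_ (count-zeros n) (mass-zeros m n)
    where
    count-zeros : ∀ n → count (Bool._≟ true) (replicate n false) ≡ 0
    count-zeros zero    = refl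
    count-zeros (suc n) = count-zeros n

  zeros-avoids : ∀ m n (π : Permutation′ (suc k)) → zeros m n Avoidsᴹ permutationMatrix π
  zeros-avoids m n π (r , c , _ , _ , covers) = contradiction
    (trans (sym (entry-zeros (lookup r zero) (lookup c (π ⟨$⟩ʳ zero))))
           (covers zero (π ⟨$⟩ʳ zero) diagonal))
    (λ ())
    where
    entry-zeros : ∀ i j → entry (zeros m n) i j ≡ false
    entry-zeros i j = trans (cong (λ row → lookup row j) (lookup-replicate i (replicate n false)))
                            (lookup-replicate j false)

    diagonal : entry (permutationMatrix π) zero (π ⟨$⟩ʳ zero) ≡ true
    diagonal = trans (lookup∘tabulate (λ j → does (π ⟨$⟩ʳ zero Fin.≟ j)) (π ⟨$⟩ʳ zero))
                     (dec-true (π ⟨$⟩ʳ zero Fin.≟ π ⟨$⟩ʳ zero) refl)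

-- The zero matrix avoids every k × k permutation matrix with k ≥ 1, so the
-- default value 0 in the definition of `ex` is then itself an admissible mass.
ex-attained : ∀ n (π : Permutation′ (suc k)) →
  ∃[ A ] A Avoidsᴹ permutationMatrix π × mass A ≡ ex n π
ex-attained n π with argmax-sel id 0 (map mass (filter (avoidsᴹ? (permutationMatrix π)) (matrices n n)))
... | inj₁ ex≡0 = zeros n n , zeros-avoids n n π , trans (mass-zeros n n) (sym ex≡0)
... | inj₂ ex∈  with A , A∈ , ex≡ ← ∈-map⁻ mass ex∈ =
  A , proj₂ (∈-filter⁻ (avoidsᴹ? (permutationMatrix π)) {xs = matrices n n} A∈) , sym ex≡

-- Two-sided Dedekind cuts: Lower is the set of rationals below the number,
-- Upper the set of those above it.
record ℝ : Set₁ where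
  field
    Lower Upper     : Pred ℚ 0ℓ
    lower-inhabited : ∃ Lower
    upper-inhabited : ∃ Upper
    lower-closed    : ∀ {p q} → p < q → Lower q → Lower p
    upper-closed    : ∀ {p q} → p < q → Upper p → Upper q
    lower-open      : ∀ {p} → Lower p → ∃[ q ] p < q × Lower q
    upper-open      : ∀ {q} → Upper q → ∃[ p ] p < q × Upper p
    disjoint        : ∀ {q} → ¬ (Lower q × Upper q)
    located         : ∀ {p q} → p < q → Lower p ⊎ Upper q

open ℝ

_≤ᴿ_ : ℝ → ℝ → Set
x ≤ᴿ y = ∀ q → Lower x q → Lower y q

fromℚ : ℚ → ℝ
fromℚ a = record
  { Lower           = _< a
  ; Upper           = a <_
  ; lower-inhabited = a - 1ℚ , subst (a - 1ℚ <_) (+-identityʳ a) (+-monoʳ-< a { - 1ℚ} {0ℚ} (negative⁻¹ (- 1ℚ)))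
  ; upper-inhabited = a + 1ℚ , subst (_< a + 1ℚ) (+-identityʳ a) (+-monoʳ-< a {0ℚ} {1ℚ} (positive⁻¹ 1ℚ))
  ; lower-closed    = <-trans
  ; upper-closed    = λ p<q a<p → <-trans a<p p<q
  ; lower-open      = <-dense
  ; upper-open      = λ a<q → let m , a<m , m<q = <-dense a<q in m , m<q , a<m
  ; disjoint        = λ (q<a , a<q) → <-asym q<a a<q
  ; located         = λ p<q → located-at p<q (_ <? _)
  }
  where
  located-at : ∀ {p q} → p < q → Dec (p < a) → p < a ⊎ a < q
  located-at p<q (yes p<a) = inj₁ p<a
  located-at p<q (no  p≮a) = inj₂ (≤-<-trans (≮⇒≥ p≮a) p<q)

fromℕ : ℕ → ℝ
fromℕ a = fromℚ (+ a / 1)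

private
  *-monoˡ-<′ : ∀ {x p q} → 0ℚ < x → p < q → p * x < q * x
  *-monoˡ-<′ {x} 0<x = *-monoˡ-<-pos x {{positive 0<x}}

  *-monoʳ-≤′ : ∀ {x p q} → 0ℚ ≤ x → p ≤ q → x * p ≤ x * q
  *-monoʳ-≤′ {x} 0≤x = *-monoˡ-≤-nonNeg x {{nonNegative 0≤x}}

  *-monoˡ-≤′ : ∀ {x p q} → 0ℚ ≤ x → p ≤ q → p * x ≤ q * x
  *-monoˡ-≤′ {x} 0≤x = *-monoʳ-≤-nonNeg x {{nonNegative 0≤x}}

  *-mono-≤′ : ∀ {p q r s} → 0ℚ ≤ p → 0ℚ ≤ s → p ≤ q → r ≤ s → p * r ≤ q * s
  *-mono-≤′ 0≤p 0≤s p≤q r≤s = ≤-trans (*-monoʳ-≤′ 0≤p r≤s) (*-monoˡ-≤′ 0≤s p≤q)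

  *-cancelʳ-<′ : ∀ {x p q} → 0ℚ < x → p * x < q * x → p < q
  *-cancelʳ-<′ {x} 0<x = *-cancelʳ-<-nonNeg x {{nonNegative (<⇒≤ 0<x)}}

  ^-nonNeg : ∀ {q} → 0ℚ ≤ q → ∀ n → 0ℚ ≤ q ^ n
  ^-nonNeg 0≤q zero    = nonNegative⁻¹ 1ℚ
  ^-nonNeg {q} 0≤q (suc n) = subst (_≤ q * q ^ n) (*-zeroʳ q) (*-monoʳ-≤′ 0≤q (^-nonNeg 0≤q n))

  ^-pos : ∀ {q} → 0ℚ < q → ∀ n → 0ℚ < q ^ n
  ^-pos 0<q zero = positive⁻¹ 1ℚ
  ^-pos {q} 0<q (suc n) = subst (_< q * q ^ n) (*-zeroˡ (q ^ n)) (*-monoˡ-<′ (^-pos 0<q n) 0<q)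

  ^-mono-≤ : ∀ {p q} → 0ℚ ≤ p → p ≤ q → ∀ n → p ^ n ≤ q ^ n
  ^-mono-≤ 0≤p p≤q zero    = ≤-refl
  ^-mono-≤ 0≤p p≤q (suc n) =
    *-mono-≤′ 0≤p (^-nonNeg (≤-trans 0≤p p≤q) n) p≤q (^-mono-≤ 0≤p p≤q n)

  ^-mono-< : ∀ {p q} → 0ℚ ≤ p → p < q → ∀ n .{{_ : NonZero n}} → p ^ n < q ^ n
  ^-mono-< 0≤p p<q (suc n) = ≤-<-trans
    (*-monoʳ-≤′ 0≤p (^-mono-≤ 0≤p (<⇒≤ p<q) n))
    (*-monoˡ-<′ (^-pos (≤-<-trans 0≤p p<q) n) p<q)

  1≤⇒≤^ : ∀ {q} → 1ℚ ≤ q → ∀ n .{{_ : NonZero n}} → q ≤ q ^ n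
  1≤⇒≤^ {q} 1≤q (suc n) = subst (_≤ q * q ^ n) (*-identityʳ q)
    (*-monoʳ-≤′ 0≤q (1≤^ n))
    where
    0≤q = ≤-trans (nonNegative⁻¹ 1ℚ) 1≤q
    1≤^ : ∀ n → 1ℚ ≤ q ^ n
    1≤^ n = subst (_≤ q ^ n) (1^ n) (^-mono-≤ (nonNegative⁻¹ 1ℚ) 1≤q n)
      where
      1^ : ∀ n → 1ℚ ^ n ≡ 1ℚ
      1^ zero    = refl
      1^ (suc n) = trans (*-identityˡ _) (1^ n)

  divide : ∀ {y} → 0ℚ < y → ∀ m → ∃[ x ] x * y ≡ m
  divide {y} 0<y m = m * 1/ y ,
    trans (*-assoc m (1/ y) y) (trans (cong (m *_) (*-inverseˡ y)) (*-identityʳ m))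
    where instance _ = pos⇒nonZero y {{positive 0<y}}

  *-above : ∀ x y {a} → 0ℚ < y → x * y < a → ∃[ x′ ] x < x′ × x′ * y < a
  *-above x y 0<y xy<a with m , xy<m , m<a ← <-dense xy<a with x′ , refl ← divide 0<y m =
    x′ , *-cancelʳ-<′ {y} {x} {x′} 0<y xy<m , m<a

  *-below : ∀ x y {a} → 0ℚ < y → a < x * y → ∃[ x′ ] x′ < x × a < x′ * y
  *-below x y 0<y a<xy with m , a<m , m<xy ← <-dense a<xy with x′ , refl ← divide 0<y m =
    x′ , *-cancelʳ-<′ {y} {x′} {x} 0<y m<xy , a<m

  *-pos⁻ˡ : ∀ x y {a} → 0ℚ ≤ a → 0ℚ < y → a < x * y → 0ℚ < x
  *-pos⁻ˡ x y 0≤a 0<y a<xy = *-cancelʳ-<′ {y} {0ℚ} {x} 0<y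
    (subst (_< x * y) (sym (*-zeroˡ y)) (≤-<-trans 0≤a a<xy))

  p<p+1 : ∀ p → p < p + 1ℚ
  p<p+1 p = subst (_< p + 1ℚ) (+-identityʳ p) (+-monoʳ-< p {0ℚ} {1ℚ} (positive⁻¹ 1ℚ))

  ⊓-glb-< : ∀ {p q r} → r < p → r < q → r < p ⊓ q
  ⊓-glb-< {p} {q} r<p r<q with ⊓-sel p q
  ... | inj₁ eq = subst (_ <_) (sym eq) r<p
  ... | inj₂ eq = subst (_ <_) (sym eq) r<q

  ⊔-lub-< : ∀ {p q r} → p < r → q < r → p ⊔ q < r
  ⊔-lub-< {p} {q} p<r q<r with ⊔-sel p q
  ... | inj₁ eq = subst (_< _) (sym eq) p<r
  ... | inj₂ eq = subst (_< _) (sym eq) q<r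

  widen : ∀ q p {a} → 0ℚ ≤ q → Dec (0ℚ < q) → q * p < a → ∃[ u ] p < u × q * u < a
  widen q p {a} 0≤q (yes 0<q) q*p<a
    with u , p<u , u*q<a ← *-above p q 0<q (subst (_< a) (*-comm q p) q*p<a) =
    u , p<u , subst (_< a) (*-comm u q) u*q<a
  widen q p {a} 0≤q (no 0≮q) q*p<a =
    p + 1ℚ , p<p+1 p , subst (_< a) (trans (q*≡0 p) (sym (q*≡0 (p + 1ℚ)))) q*p<a
    where
    q*≡0 : ∀ u → q * u ≡ 0ℚ
    q*≡0 u = trans (cong (_* u) (≤-antisym (≮⇒≥ 0≮q) 0≤q)) (*-zeroˡ u)

  ^-above : ∀ q {a} n → 0ℚ ≤ q → q ^ n < a → ∃[ r ] q < r × r ^ n < a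
  ^-above q     zero    0≤q 1<a = q + 1ℚ , p<p+1 q , 1<a
  ^-above q {a} (suc n) 0≤q q*qⁿ<a
    with u , qⁿ<u , q*u<a ← widen q (q ^ n) 0≤q (0ℚ <? q) q*qⁿ<a
    with 0<u ← ≤-<-trans (^-nonNeg 0≤q n) qⁿ<u
    with x , q<x , x*u<a ← *-above q u 0<u q*u<a
       | r , q<r , rⁿ<u  ← ^-above q n 0≤q qⁿ<u =
    x ⊓ r , q<m , ≤-<-trans (*-mono-≤′ 0≤m (<⇒≤ 0<u) (p⊓q≤p x r) mⁿ≤u) x*u<a
    where
    q<m : q < x ⊓ r
    q<m = ⊓-glb-< q<x q<r

    0≤m : 0ℚ ≤ x ⊓ r
    0≤m = ≤-trans 0≤q (<⇒≤ q<m)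

    mⁿ≤u : (x ⊓ r) ^ n ≤ u
    mⁿ≤u = ≤-trans (^-mono-≤ 0≤m (p⊓q≤q x r) n) (<⇒≤ rⁿ<u)

  ^-below : ∀ q {a} n → 0ℚ < q → 0ℚ ≤ a → a < q ^ n → ∃[ r ] 0ℚ < r × r < q × a < r ^ n
  ^-below q     zero    0<q 0≤a a<1
    with r , 0<r , r<q ← <-dense 0<q = r , 0<r , r<q , a<1
  ^-below q {a} (suc n) 0<q 0≤a a<q*qⁿ
    with 0<qⁿ ← ^-pos 0<q n
    with x , x<q , a<x*qⁿ ← *-below q (q ^ n) 0<qⁿ a<q*qⁿ
    with 0<x ← *-pos⁻ˡ x (q ^ n) 0≤a 0<qⁿ a<x*qⁿ
    with u , u<qⁿ , a<u*x ← *-below (q ^ n) x 0<x (subst (a <_) (*-comm x (q ^ n)) a<x*qⁿ)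
    with 0<u ← *-pos⁻ˡ u x 0≤a 0<x a<u*x
    with r , 0<r , r<q , u<rⁿ ← ^-below q n 0<q (<⇒≤ 0<u) u<qⁿ =
    x ⊔ r , 0<m , ⊔-lub-< x<q r<q ,
    <-≤-trans (subst (a <_) (*-comm u x) a<u*x)
      (*-mono-≤′ (<⇒≤ 0<x) (^-nonNeg (<⇒≤ 0<m) n) (p≤p⊔q x r) u≤mⁿ)
    where
    0<m : 0ℚ < x ⊔ r
    0<m = <-≤-trans 0<x (p≤p⊔q x r)

    u≤mⁿ : u ≤ (x ⊔ r) ^ n
    u≤mⁿ = ≤-trans (<⇒≤ u<rⁿ) (^-mono-≤ (<⇒≤ 0<r) (p≤q⊔p x r) n)

-- The non-negative real a^(1/n).  Negative q belong to Lower explicitly, since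
-- q ^ n < a fails for q ≪ 0 when n is even.
root : (n : ℕ) .{{_ : NonZero n}} → ℕ → ℝ
root n a = record
  { Lower           = λ q → q < 0ℚ ⊎ q ^ n < a′
  ; Upper           = λ q → 0ℚ < q × a′ < q ^ n
  ; lower-inhabited = - 1ℚ , inj₁ (negative⁻¹ (- 1ℚ))
  ; upper-inhabited = a′ + 1ℚ , ≤-<-trans 0≤a′ (p<p+1 a′) ,
      <-≤-trans (p<p+1 a′) (1≤⇒≤^ (subst (_≤ a′ + 1ℚ) (+-identityˡ 1ℚ) (+-monoˡ-≤ 1ℚ 0≤a′)) n)
  ; lower-closed    = lower-closed′ (_ <? _)
  ; upper-closed    = λ p<q (0<p , a<pⁿ) →
      <-trans 0<p p<q , <-≤-trans a<pⁿ (^-mono-≤ (<⇒≤ 0<p) (<⇒≤ p<q) n)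
  ; lower-open      = lower-open′ (_ <? _)
  ; upper-open      = λ (0<q , a<qⁿ) →
      let r , 0<r , r<q , a<rⁿ = ^-below _ n 0<q 0≤a′ a<qⁿ in r , r<q , 0<r , a<rⁿ
  ; disjoint        = λ { (inj₁ q<0  , 0<q , _)  → <-asym q<0 0<q
                        ; (inj₂ qⁿ<a , _ , a<qⁿ) → <-asym qⁿ<a a<qⁿ }
  ; located         = located′ (_ <? _) (_ <? _)
  }
  where
  a′ : ℚ
  a′ = + a / 1

  0≤a′ : 0ℚ ≤ a′
  0≤a′ = nonNegative⁻¹ a′ {{normalize-nonNeg a 1}}

  L U : Pred ℚ 0ℓ
  L q = q < 0ℚ ⊎ q ^ n < a′
  U q = 0ℚ < q × a′ < q ^ n

  lower-closed′ : ∀ {p q} → Dec (p < 0ℚ) → p < q → L q → L p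
  lower-closed′ (yes p<0) _   _           = inj₁ p<0
  lower-closed′ (no  p≮0) p<q (inj₁ q<0)  = inj₁ (<-trans p<q q<0)
  lower-closed′ (no  p≮0) p<q (inj₂ qⁿ<a) =
    inj₂ (≤-<-trans (^-mono-≤ (≮⇒≥ p≮0) (<⇒≤ p<q) n) qⁿ<a)

  lower-open′ : ∀ {p} → Dec (p < 0ℚ) → L p → ∃[ q ] p < q × L q
  lower-open′ (yes p<0) _ = let q , p<q , q<0 = <-dense p<0 in q , p<q , inj₁ q<0
  lower-open′ (no  p≮0) (inj₁ p<0)  = contradiction p<0 p≮0
  lower-open′ (no  p≮0) (inj₂ pⁿ<a) =
    let q , p<q , qⁿ<a = ^-above _ n (≮⇒≥ p≮0) pⁿ<a in q , p<q , inj₂ qⁿ<a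

  located′ : ∀ {p q} → Dec (p < 0ℚ) → Dec (p ^ n < a′) → p < q → L p ⊎ U q
  located′ (yes p<0) _          _   = inj₁ (inj₁ p<0)
  located′ (no  p≮0) (yes pⁿ<a) _   = inj₁ (inj₂ pⁿ<a)
  located′ (no  p≮0) (no  pⁿ≮a) p<q =
    inj₂ (≤-<-trans (≮⇒≥ p≮0) p<q , ≤-<-trans (≮⇒≥ pⁿ≮a) (^-mono-< (≮⇒≥ p≮0) p<q n))

-- x < y + ε, i.e. some rational q satisfies x < q and q - ε < y.
_<ᴿ_+_ : ℝ → ℝ → ℚ → Set
x <ᴿ y + ε = ∃[ q ] Upper x q × Lower y (q - ε)

-- |x - y| < ε
∣_-_∣<_ : ℝ → ℝ → ℚ → Set
∣ x - y ∣< ε = (x <ᴿ y + ε) × (y <ᴿ x + ε)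

-- Sequences are indexed by the positive integers, where 1/n makes sense.
_⟶_ : ((n : ℕ) .{{_ : NonZero n}} → ℝ) → ℝ → Set
u ⟶ x = ∀ ε → 0ℚ < ε → ∃[ N ] (∀ n .{{_ : NonZero n}} → N ℕ.≤ n → ∣ u n - x ∣< ε)

IsFürediHajnalLimit : Permutation′ k → ℝ → Set
IsFürediHajnalLimit π c = (λ n → fromℚ (+ ex n π / n)) ⟶ c

IsStanleyWilfLimit : Permutation′ k → ℝ → Set
IsStanleyWilfLimit π L = (λ n → root n (S n π)) ⟶ L

{-# OPTIONS --safe #-}
module Submission where

-- Marcus-Tardos recursion with Fox's interval minors.  Cut a matrix that avoids π
-- into t × t blocks.  The matrix of nonzero blocks still avoids π; a block meeting
-- fewer than s rows and columns has at most s² ones; and a block column contains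
-- few blocks meeting at least s columns, since many of them have k rows and k
-- column intervals such that every row hits every interval, which gives a copy of
-- π.  With s = 2ᵏ⁻¹ and t = 2 s² this yields ex(n) ≤ D n for D = 2^O(k).  For L,
-- contract an n × n permutation matrix to side n / D.  By Klazar's refinement
-- argument there are at most 16ⁿ contractions, and each comes from at most
-- (2 D²)ⁿ permutations, because it has at most n ones.

open import Defs
open import Data.Fin.Permutation using (Permutation′)
open import Data.Nat.Base using (ℕ; _*_; _^_; _≤_; _<_)
open import Data.Product.Base using (_×_; ∃-syntax)
open import Data.Bool.Base using (Bool; true; false; T; if_then_else_)
import Data.Bool.Properties as Bool
open import Data.Bool.Properties using (T?; T-≡)
open import Data.Fin.Base as Fin using (Fin; zero; suc; toℕ; fromℕ<)
open import Data.Fin.Permutation as Perm using (_⟨$⟩ʳ_; _⟨$⟩ˡ_; inverseˡ; inverseʳ)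
import Data.Fin.Properties as Fin
import Data.Integer.Base as ℤ
import Data.Integer.Properties as ℤ
open import Data.List.Base as List using (List; []; _∷_; concatMap; length)
open import Data.List.Membership.Propositional.Properties using (∈-lookup)
open import Data.List.Properties using (length-++; length-map)
open import Data.List.Relation.Unary.All as All using (All)
import Data.List.Relation.Unary.All.Properties as All
open import Data.List.Relation.Unary.AllPairs using ([]; _∷_)
open import Data.List.Relation.Unary.Any as Any using (Any; here; there)
import Data.List.Relation.Unary.Any.Properties as Any
open import Data.List.Relation.Unary.Unique.Setoid using (Unique)
import Data.List.Relation.Unary.Unique.Setoid.Properties as Unique
open import Data.Nat.Base hiding (ℕ; _*_; _^_; _≤_; _<_)
open import Data.Nat.Divisibility using (divides-refl)
open import Data.Nat.DivMod
open import Data.Nat.Induction using (<-rec)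
open import Data.Nat.Properties
open import Data.Nat.Tactic.RingSolver using (solve-∀)
open import Data.Product.Base using (_,_; proj₁; proj₂; Σ-syntax)
open import Data.Rational.Base as ℚ using (0ℚ; toℚᵘ)
import Data.Rational.Properties as ℚ
open import Data.Rational.Solver using (module +-*-Solver)
open import Data.Rational.Unnormalised.Base as ℚᵘ using (mkℚᵘ; *≤*)
import Data.Rational.Unnormalised.Properties as ℚᵘ
open import Data.Sum.Base using (_⊎_; inj₁; inj₂; [_,_]′)
open import Data.Unit.Base using (tt)
open import Data.Vec.Base using (Vec; []; _∷_; _∷ʳ_; lookup; tabulate; replicate; count)
open import Data.Vec.Properties using (lookup∘tabulate)
open import Function.Base using (_∘_; flip; id)
open import Function.Bundles using (mk⇔; Equivalence)
open import Level using (0ℓ)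
open import Relation.Binary.Bundles using (Setoid)
open import Relation.Binary.Core using (REL)
open import Relation.Binary.Definitions using (tri<; tri≈; tri>)
open import Relation.Binary.PropositionalEquality
  using (_≡_; refl; sym; trans; cong; cong₂; subst; subst₂)
open import Relation.Nullary using (¬_; Dec; yes; no; does; contradiction)
open import Relation.Nullary.Decidable using (⌊_⌋; toWitness; fromWitness; dec-true)
open import Relation.Unary using (Pred; Decidable; _∪_; _∩_; _⊆_)

open import Algebra.Definitions.RawSemiring ℚ.+-*-rawSemiring using () renaming (_^_ to _^ℚ_)
open import Algebra.Properties.Semiring.Sum +-*-semiring
  using (sum; sum-cong-≗; ∑-comm; ∑-distrib-+; *-distribˡ-sum; *-distribʳ-sum)

private
  variable
    a b c d k l m n : ℕ
    f               : ℕ → Bool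
    A A′ X Y        : Set
    P Q             : Pred A 0ℓ
    R R′            : REL A X 0ℓ

-- Sums over initial segments of the naturals.

∑ : ℕ → (ℕ → ℕ) → ℕ
∑ n f = sum {n} (f ∘ toℕ)

∑-mono-≤ : ∀ n {f g} → (∀ i → i < n → f i ≤ g i) → ∑ n f ≤ ∑ n g
∑-mono-≤ zero    f≤g = z≤n
∑-mono-≤ (suc n) f≤g = +-mono-≤ (f≤g 0 z<s) (∑-mono-≤ n λ i i<n → f≤g (suc i) (s<s i<n))

∑-cong : ∀ n {f g} → (∀ i → i < n → f i ≡ g i) → ∑ n f ≡ ∑ n g
∑-cong n f≡g = sum-cong-≗ λ i → f≡g (toℕ i) (Fin.toℕ<n i)

∑-≤-const : ∀ n {f c} → (∀ i → i < n → f i ≤ c) → ∑ n f ≤ n * c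
∑-≤-const zero    f≤c = z≤n
∑-≤-const (suc n) f≤c = +-mono-≤ (f≤c 0 z<s) (∑-≤-const n λ i i<n → f≤c (suc i) (s<s i<n))

∑-+ : ∀ m n f → ∑ (m + n) f ≡ ∑ m f + ∑ n (f ∘ (m +_))
∑-+ zero    n f = refl
∑-+ (suc m) n f = trans (cong (f 0 +_) (∑-+ m n (f ∘ suc))) (sym (+-assoc (f 0) _ _))

∑-* : ∀ N t f → ∑ (N * t) f ≡ ∑ N λ i → ∑ t λ j → f (i * t + j)
∑-* zero    t f = refl
∑-* (suc N) t f = trans (∑-+ t (N * t) f) (cong (∑ t f +_)
  (trans (∑-* N t (f ∘ (t +_)))
    (∑-cong N λ i _ → ∑-cong t λ j _ → cong f (sym (+-assoc t (i * t) j)))))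

ι : Bool → ℕ
ι true  = 1
ι false = 0

ι≤1 : ∀ x → ι x ≤ 1
ι≤1 true  = ≤-refl
ι≤1 false = z≤n

ι-T : ∀ {x} → T x → ι x ≡ 1
ι-T {true} _ = refl

∑-ι-pos : ∀ n (f : ℕ → Bool) → 1 ≤ ∑ n (ι ∘ f) → ∃[ i ] i < n × T (f i)
∑-ι-pos (suc n) f 1≤ with f 0 in eq
... | true  = 0 , z<s , subst T (sym eq) tt
... | false with i , i<n , fi ← ∑-ι-pos n (f ∘ suc) 1≤ = suc i , s<s i<n , fi

-- Increasing chains of naturals and the pigeonhole principle.

-- A chain stands for a finite set of given size inside `P`. The lower bound is an index, so that
-- strict increase holds by construction; no upper bound is kept.
data Chain (P : Pred ℕ 0ℓ) : ℕ → ℕ → Set where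
  []  : Chain P a 0
  cons : ∀ x → a ≤ x → P x → Chain P (suc x) n → Chain P a (suc n)

chain-weaken : a ≤ b → Chain P b n → Chain P a n
chain-weaken a≤b []                = []
chain-weaken a≤b (cons x b≤x Px c) = cons x (≤-trans a≤b b≤x) Px c

chain-map : P ⊆ Q → Chain P a n → Chain Q a n
chain-map P⊆Q []                = []
chain-map P⊆Q (cons x a≤x Px c) = cons x a≤x (P⊆Q Px) (chain-map P⊆Q c)

chain-take : m ≤ n → Chain P a n → Chain P a m
chain-take z≤n       c                 = []
chain-take (s≤s m≤n) (cons x a≤x Px c) = cons x a≤x Px (chain-take m≤n c)

chain-shift : Chain (P ∘ suc) a n → Chain P (suc a) n
chain-shift []                = []
chain-shift (cons x a≤x Px c) = cons (suc x) (s≤s a≤x) Px (chain-shift c)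

chain-partition : Chain (P ∪ Q) a n → ∃[ p ] ∃[ q ] p + q ≡ n × Chain P a p × Chain Q a q
chain-partition [] = 0 , 0 , refl , [] , []
chain-partition (cons x a≤x PQx c) with chain-partition c | PQx
... | p , q , eq , cp , cq | inj₁ Px =
  suc p , q , cong suc eq , cons x a≤x Px cp , chain-weaken (m≤n⇒m≤1+n a≤x) cq
... | p , q , eq , cp , cq | inj₂ Qx =
  p , suc q , trans (+-suc p q) (cong suc eq) , chain-weaken (m≤n⇒m≤1+n a≤x) cp , cons x a≤x Qx cq

-- Pigeonhole: the two parts have `m + n` elements together, so one of them reaches its share, and
-- its surplus is cut off.
chain-split : ∀ m n → Chain (P ∪ Q) a (m + n) → Chain P a m ⊎ Chain Q a n
chain-split m n c with p , q , eq , cp , cq ← chain-partition c | m ≤? p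
... | yes m≤p = inj₁ (chain-take m≤p cp)
... | no  m≰p = inj₂ (chain-take n≤q cq)
  where
  n≤q : n ≤ q
  n≤q = +-cancelˡ-≤ m n q (≤-trans (≤-reflexive (sym eq)) (+-monoˡ-≤ q (≰⇒≥ m≰p)))

chain-filter : (P? : Decidable P) → ∀ n → Chain P 0 (∑ n λ x → ι ⌊ P? x ⌋)
chain-filter P? zero    = []
chain-filter P? (suc n) with P? 0 | chain-shift (chain-filter (P? ∘ suc) n)
... | yes P0 | c = cons 0 z≤n P0 c
... | no  _  | c = chain-weaken z≤n c

chain-lookup : Chain P a n → Fin n → ℕ
chain-lookup (cons x _ _ c) zero    = x
chain-lookup (cons x _ _ c) (suc i) = chain-lookup c i

chain-lookup-≥ : (c : Chain P a n) → ∀ i → a ≤ chain-lookup c i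
chain-lookup-≥ (cons x a≤x _ c) zero    = a≤x
chain-lookup-≥ (cons x a≤x _ c) (suc i) = ≤-trans (m≤n⇒m≤1+n a≤x) (chain-lookup-≥ c i)

chain-lookup-< : (c : Chain P a n) → ∀ {i j} → i Fin.< j → chain-lookup c i < chain-lookup c j
chain-lookup-< (cons x _ _ c) {zero}  {suc j} _   = chain-lookup-≥ c j
chain-lookup-< (cons x _ _ c) {suc i} {suc j} i<j = chain-lookup-< c (s<s⁻¹ i<j)

chain-lookup-P : (c : Chain P a n) → ∀ i → P (chain-lookup c i)
chain-lookup-P (cons x _ Px c) zero    = Px
chain-lookup-P (cons x _ Px c) (suc i) = chain-lookup-P c i

-- Rows that hit consecutive intervals.

Hit : (ℕ → Bool) → ℕ → ℕ → Set
Hit f a b = ∃[ x ] a ≤ x × x < b × T (f x)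

-- The cuts cs bound consecutive intervals [a , c₁), [c₁ , c₂), ...; no one is
-- required between the last cut and b.
HitsAll : (ℕ → Bool) → ℕ → ℕ → Vec ℕ l → Set
HitsAll f a b []       = a ≤ b
HitsAll f a b (c ∷ cs) = Hit f a c × HitsAll f c b cs

Hit-extendˡ : a ≤ b → Hit f b c → Hit f a c
Hit-extendˡ a≤b (x , b≤x , x<c , fx) = x , ≤-trans a≤b b≤x , x<c , fx

HitsAll-extendˡ : ∀ (cs : Vec ℕ l) → a ≤ b → HitsAll f b c cs → HitsAll f a c cs
HitsAll-extendˡ []       a≤b b≤c      = ≤-trans a≤b b≤c
HitsAll-extendˡ {f = f} (d ∷ cs) a≤b (h , hs) = Hit-extendˡ {f = f} a≤b h , hs

HitsAll-extendʳ : ∀ (cs : Vec ℕ l) → b ≤ c → HitsAll f a b cs → HitsAll f a c cs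
HitsAll-extendʳ []       b≤c a≤b      = ≤-trans a≤b b≤c
HitsAll-extendʳ {f = f} (d ∷ cs) b≤c (h , hs) = h , HitsAll-extendʳ {f = f} cs b≤c hs

HitsAll-∷ʳ : ∀ (cs : Vec ℕ l) → HitsAll f a b cs → Hit f b c → HitsAll f a c (cs ∷ʳ c)
HitsAll-∷ʳ {f = f} []       a≤b      h = Hit-extendˡ {f = f} a≤b h , ≤-refl
HitsAll-∷ʳ {f = f} (d ∷ cs) (h , hs) h′ = h , HitsAll-∷ʳ {f = f} cs hs h′

Increasingℕ : (Fin n → ℕ) → Set
Increasingℕ f = ∀ {i j} → i Fin.< j → f i < f j

-- Only the hit of `f j` in the interval of index `j` is taken, and consecutive intervals make the
-- points increase. As every function hits every interval, the functions may be indexed in any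
-- order; this is what lets an arbitrary π be realised.
transversal : ∀ (f : Fin l → ℕ → Bool) (cs : Vec ℕ l) → (∀ j → HitsAll (f j) a b cs) →
  ∃[ x ] (∀ j → a ≤ x j) × Increasingℕ {l} x × (∀ j → T (f j (x j)))
transversal f []       hits = (λ ()) , (λ ()) , (λ {}) , λ ()
transversal {l = suc l} {a} f (c ∷ cs) hits
  with y , a≤y , y<c , fy ← proj₁ (hits zero)
     | x , c≤x , x-incr , fx ← transversal (f ∘ suc) cs (proj₂ ∘ hits ∘ suc) =
  x′ , a≤x′ , incr , fx′
  where
  x′ : Fin (suc l) → ℕ
  x′ zero    = y
  x′ (suc j) = x j

  a≤x′ : ∀ j → a ≤ x′ j
  a≤x′ zero    = a≤y
  a≤x′ (suc j) = ≤-trans a≤y (≤-trans (<⇒≤ y<c) (c≤x j))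

  incr : Increasingℕ x′
  incr {zero}  {suc j} _   = <-≤-trans y<c (c≤x j)
  incr {suc i} {suc j} i<j = x-incr (s<s⁻¹ i<j)

  fx′ : ∀ j → T (f j (x′ j))
  fx′ zero    = fy
  fx′ (suc j) = fx j

ones : (ℕ → Bool) → ℕ → ℕ → ℕ
ones f a w = ∑ w λ x → ι (f (a + x))

ones-double : ∀ f a w → ones f a (2 * w) ≡ ones f a w + ones f (a + w) w
ones-double f a w = trans (cong (ones f a) (cong (w +_) (+-identityʳ w)))
  (trans (∑-+ w w (ι ∘ f ∘ (a +_))) (cong (ones f a w +_)
    (∑-cong w λ x _ → cong (ι ∘ f) (sym (+-assoc a w x)))))

ones≥1⇒Hit : ∀ {w} → 1 ≤ ones f a w → Hit f a (a + w)
ones≥1⇒Hit {f} {a} {w} 1≤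
  with x , x<w , fx ← ∑-ι-pos w (f ∘ (a +_)) 1≤ = a + x , m≤m+n a x , +-monoʳ-< a x<w , fx

-- If neither summand reaches `2 * s` alone, then neither is 0, and the larger one is at least `s`.
halve : ∀ s {x y} → 2 * s ≤ x + y →
  (2 * s ≤ x ⊎ 2 * s ≤ y) ⊎ (s ≤ x × 1 ≤ y ⊎ s ≤ y × 1 ≤ x)
halve s {x} {y} 2s≤x+y with 2 * s ≤? x | 2 * s ≤? y | s ≤? x
... | yes 2s≤x | _        | _       = inj₁ (inj₁ 2s≤x)
... | no _     | yes 2s≤y | _       = inj₁ (inj₂ 2s≤y)
... | no 2s≰x  | no _     | yes s≤x = inj₂ (inj₁ (s≤x , ≰⇒> λ y≤0 → 2s≰x
      (≤-trans 2s≤x+y (≤-trans (+-monoʳ-≤ x y≤0) (≤-reflexive (+-identityʳ x))))))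
... | no _     | no 2s≰y  | no s≰x  = inj₂ (inj₂ (s≤y , ≰⇒> λ x≤0 → 2s≰y
      (≤-trans 2s≤x+y (+-monoˡ-≤ y x≤0))))
  where
  s≤y : s ≤ y
  s≤y = ≤-trans (m≤m+n s 0)
    (+-cancelˡ-≤ s (s + 0) y (≤-trans 2s≤x+y (+-monoˡ-≤ y (≰⇒≥ s≰x))))

-- Halve the column range: a row either keeps its 2ˡ ones in one half, or has 2ˡ⁻¹
-- ones in one half and hits the other half, which then serves as an extra interval.
intervalMinor : ∀ (M : ℕ → ℕ → Bool) {r} → 1 ≤ r → ∀ l m →
  (∀ {x} → P x → 2 ^ l ≤ ones (M x) a (2 ^ m)) → Chain P b (r * 4 ^ m) →
  ∃[ cs ] Chain (P ∩ λ x → HitsAll {suc l} (M x) a (a + 2 ^ m) cs) b r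
intervalMinor {a = a} M {r} 1≤r zero m dense c = (a + 2 ^ m) ∷ [] ,
  chain-take (m≤m*n r (4 ^ m))
    -- The whole range is the single interval, and `2 ^ 0` ones are enough to hit it.
    (chain-map (λ {x} Px → Px , ones≥1⇒Hit {f = M x} (dense Px) , ≤-refl) c)
  where instance _ = m^n≢0 4 m
intervalMinor {P} {a} {b} M {r} 1≤r (suc l) zero dense c =
  -- A range of width 1 cannot hold two ones, so a single row is already contradictory; `1 ≤ r`
  -- provides one.
  impossible (chain-take (≤-trans 1≤r (m≤m*n r 1)) c)
  where
  impossible : Chain P b 1 → _
  impossible (cons x _ Px _) = contradiction
    (≤-trans (^-monoʳ-≤ 2 {1} {suc l} (s≤s z≤n))
      (≤-trans (dense Px) (+-monoˡ-≤ 0 (ι≤1 (M x (a + 0))))))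
    (<⇒≱ (s≤s (s≤s z≤n)))
intervalMinor {P} {a} {b} M {r} 1≤r (suc l) (suc m) dense c =
  -- The rows fall into four classes, and the factor 4 in `4 ^ suc m` leaves `r * 4 ^ m` rows in one
  -- of them. For `c₁` and `c₂` all intervals come from one half; for `c₃` and `c₄` the recursion
  -- finds one interval fewer, and the other half is added at the right or left end.
  [ [ (λ c₁ → let cs , d = intervalMinor M 1≤r (suc l) m proj₂ c₁ in
          cs , chain-map (λ {x} ((Px , _) , hs) → Px , HitsAll-extendʳ {f = M x} cs mid≤ hs) d)
    , (λ c₂ → let cs , d = intervalMinor M 1≤r (suc l) m proj₂ c₂ in
          cs , chain-map (λ {x} ((Px , _) , hs) → Px ,
            subst (λ e → HitsAll (M x) a e cs) end≡
              (HitsAll-extendˡ {f = M x} cs (m≤m+n a w) hs)) d)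
    ]′ ∘ chain-split _ _
  , [ (λ c₃ → let cs , d = intervalMinor M 1≤r l m (proj₁ ∘ proj₂) c₃ in
          cs ∷ʳ (a + 2 ^ suc m) , chain-map (λ {x} ((Px , _ , 1≤) , hs) → Px ,
            HitsAll-∷ʳ {f = M x} cs hs
              (subst (Hit (M x) (a + w)) end≡ (ones≥1⇒Hit {f = M x} 1≤))) d)
    , (λ c₄ → let cs , d = intervalMinor M 1≤r l m (proj₁ ∘ proj₂) c₄ in
          (a + w) ∷ cs , chain-map (λ {x} ((Px , _ , 1≤) , hs) → Px ,
            ones≥1⇒Hit {f = M x} 1≤ , subst (λ e → HitsAll (M x) (a + w) e cs) end≡ hs) d)
    ]′ ∘ chain-split _ _
  ]′ (chain-split _ _ classified)
  where
  w q : ℕ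
  w = 2 ^ m
  q = r * 4 ^ m

  end≡ : a + w + w ≡ a + 2 ^ suc m
  end≡ = trans (+-assoc a w w) (cong (λ v → a + (w + v)) (sym (+-identityʳ w)))

  mid≤ : a + w ≤ a + 2 ^ suc m
  mid≤ = +-monoʳ-≤ a (m≤m+n w (1 * w))

  left right : ℕ → ℕ
  left  x = ones (M x) a w
  right x = ones (M x) (a + w) w

  P₁ P₂ P₃ P₄ : Pred ℕ 0ℓ
  P₁ x = P x × 2 ^ suc l ≤ left x
  P₂ x = P x × 2 ^ suc l ≤ right x
  P₃ x = P x × 2 ^ l ≤ left x × 1 ≤ right x
  P₄ x = P x × 2 ^ l ≤ right x × 1 ≤ left x

  classify : P ⊆ (P₁ ∪ P₂) ∪ (P₃ ∪ P₄)
  classify {x} Px =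
    [ [ inj₁ ∘ inj₁ ∘ (Px ,_) , inj₁ ∘ inj₂ ∘ (Px ,_) ]′
    , [ inj₂ ∘ inj₁ ∘ (Px ,_) , inj₂ ∘ inj₂ ∘ (Px ,_) ]′ ]′
    (halve (2 ^ l) (subst (2 ^ suc l ≤_) (ones-double (M x) a w) (dense Px)))

  classified : Chain ((P₁ ∪ P₂) ∪ (P₃ ∪ P₄)) b ((q + q) + (q + q))
  classified = subst (Chain _ b) (lemma r (4 ^ m)) (chain-map classify c)
    where
    lemma : ∀ r x → r * (4 * x) ≡ (r * x + r * x) + (r * x + r * x)
    lemma = solve-∀

-- Matrices as grids, copies of π, and contraction of blocks.

-- A finite matrix is padded with zeros, so every copy of a pattern lies inside it.
Grid : Set
Grid = ℕ → ℕ → Bool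

weight : ℕ → Grid → ℕ
weight n A = ∑ n λ i → ∑ n λ j → ι (A i j)

Copy : Permutation′ k → Grid → Set
Copy {k} π A = ∃[ r ] ∃[ c ] Increasingℕ {k} r × Increasingℕ {k} c ×
  (∀ i → T (A (r i) (c (π ⟨$⟩ʳ i))))

-- Transposition turns π into its inverse. This reduces tall blocks in a block row to wide blocks in
-- a block column.
Copy-flip : ∀ (π : Permutation′ k) A → Copy (Perm.flip π) (flip A) → Copy π A
Copy-flip π A (r , c , r-incr , c-incr , ones) = c , r , c-incr , r-incr , λ i →
  subst (λ j → T (A (c j) (r (π ⟨$⟩ʳ i)))) (inverseˡ π) (ones (π ⟨$⟩ʳ i))

block : ℕ → Grid → ℕ → ℕ → Grid
block t A I J x y = A (I * t + x) (J * t + y)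

nonzero? : ∀ t (G : Grid) → Dec (∃[ x ] x < t × ∃[ y ] y < t × T (G x y))
nonzero? t G = anyUpTo? (λ x → anyUpTo? (λ y → T? (G x y)) t) t

contract : ℕ → Grid → Grid
contract t A I J = ⌊ nonzero? t (block t A I J) ⌋

block-< : ∀ {t I J x y} → I < J → x < t → I * t + x < J * t + y
block-< {t} {I} {J} {x} {y} I<J x<t = begin-strict
  I * t + x  <⟨ +-monoʳ-< (I * t) x<t ⟩
  I * t + t  ≡⟨ +-comm (I * t) t ⟩
  suc I * t  ≤⟨ *-monoˡ-≤ t I<J ⟩
  J * t      ≤⟨ m≤m+n (J * t) y ⟩
  J * t + y  ∎
  where open ≤-Reasoning

-- Any one-entry of each chosen block will do: these blocks lie in distinct block rows and block
-- columns, so the order of the blocks decides the order of the entries.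
Copy-contract : ∀ (π : Permutation′ k) t A → Copy π (contract t A) → Copy π A
Copy-contract {k} π t A (r , c , r-incr , c-incr , ones) =
  (λ i → r i * t + x i) , (λ j → c j * t + y (π ⟨$⟩ˡ j)) ,
  (λ {i} i<j → block-< (r-incr i<j) (proj₁ (proj₂ (hit i)))) ,
  (λ {i} i<j → block-< (c-incr i<j) (proj₁ (proj₂ (proj₂ (proj₂ (hit (π ⟨$⟩ˡ i))))))) ,
  λ i → subst (λ j → T (A (r i * t + x i) (c (π ⟨$⟩ʳ i) * t + y j))) (sym (inverseˡ π))
          (proj₂ (proj₂ (proj₂ (proj₂ (hit i)))))
  where
  hit : ∀ i → _
  hit i = toWitness {a? = nonzero? t (block t A (r i) (c (π ⟨$⟩ʳ i)))} (ones i)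

  x y : Fin k → ℕ
  x i = proj₁ (hit i)
  y i = proj₁ (proj₂ (proj₂ (hit i)))

-- Wide and tall blocks, and the recursion for the weight.

columnHit? : ∀ t (G : Grid) y → Dec (∃[ x ] x < t × T (G x y))
columnHit? t G y = anyUpTo? (λ x → T? (G x y)) t

columnHits : ℕ → Grid → ℕ
columnHits t G = ∑ t λ y → ι ⌊ columnHit? t G y ⌋

-- All ones lie in the product of the nonempty rows, counted through the transpose, and the nonempty
-- columns.
weight-≤-hits : ∀ t G → weight t G ≤ columnHits t (flip G) * columnHits t G
weight-≤-hits t G = ≤-trans
  (∑-mono-≤ t λ x x<t → ∑-mono-≤ t λ y y<t → entry≤ x y x<t y<t)
  (≤-reflexive (trans
    (∑-cong t {g = λ x → row x * columnHits t G} λ x _ →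
      sym (*-distribˡ-sum (row x) λ y → ι ⌊ columnHit? t G (toℕ {t} y) ⌋))
    (sym (*-distribʳ-sum (columnHits t G) (row ∘ toℕ {t})))))
  where
  row : ℕ → ℕ
  row x = ι ⌊ columnHit? t (flip G) x ⌋

  entry≤ : ∀ x y → x < t → y < t → ι (G x y) ≤ row x * ι ⌊ columnHit? t G y ⌋
  entry≤ x y x<t y<t with G x y in eq
  ... | false = z≤n
  ... | true  = ≤-reflexive (sym (cong₂ _*_
    (ι-T (fromWitness {a? = columnHit? t (flip G) x} (y , y<t , subst T (sym eq) tt)))
    (ι-T (fromWitness {a? = columnHit? t G y} (x , x<t , subst T (sym eq) tt)))))

weight-≤-square : ∀ t G → weight t G ≤ t * t
weight-≤-square t G = ∑-≤-const t λ x _ →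
  ≤-trans (∑-≤-const t λ y _ → ι≤1 (G x y)) (≤-reflexive (*-identityʳ t))

weight-zero : ∀ t G → ¬ (∃[ x ] x < t × ∃[ y ] y < t × T (G x y)) → weight t G ≡ 0
weight-zero t G ∄ = n≤0⇒n≡0 (≤-trans
  (∑-≤-const t λ x x<t →
    ≤-trans (∑-≤-const t λ y y<t → entry≤0 x y x<t y<t) (≤-reflexive (*-zeroʳ t)))
  (≤-reflexive (*-zeroʳ t)))
  where
  entry≤0 : ∀ x y → x < t → y < t → ι (G x y) ≤ 0
  entry≤0 x y x<t y<t with G x y in eq
  ... | false = z≤n
  ... | true  = contradiction (x , x<t , y , y<t , subst T (sym eq) tt) ∄

wide? : ∀ s t G → Dec (s ≤ columnHits t G)
wide? s t G = s ≤? columnHits t G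

-- A wide or tall block is charged its full area. Any other nonzero block has its ones in fewer than
-- `s` rows and fewer than `s` columns.
block-weight : ∀ s t G → weight t G ≤
  s * s * ι ⌊ nonzero? t G ⌋ +
    (t * t * ι ⌊ wide? s t G ⌋ + t * t * ι ⌊ wide? s t (flip G) ⌋)
block-weight s t G with nonzero? t G | wide? s t G | wide? s t (flip G)
... | no ∄  | _       | _       = ≤-trans (≤-reflexive (weight-zero t G ∄)) z≤n
... | yes _ | yes _   | _       = ≤-trans (weight-≤-square t G) (≤-trans
        (≤-reflexive (sym (*-identityʳ (t * t)))) (≤-trans (m≤m+n _ _) (m≤n+m _ (s * s * 1))))
... | yes _ | no _    | yes _   = ≤-trans (weight-≤-square t G) (≤-trans
        (≤-reflexive (sym (*-identityʳ (t * t))))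
        (≤-trans (m≤n+m _ (t * t * 0)) (m≤n+m _ (s * s * 1))))
... | yes _ | no ¬wide | no ¬tall = ≤-trans (weight-≤-hits t G) (≤-trans
        (*-mono-≤ (≰⇒≥ ¬tall) (≰⇒≥ ¬wide)) (≤-trans
          (≤-reflexive (sym (*-identityʳ (s * s)))) (m≤m+n (s * s * 1) _)))

∑²-comm : ∀ m n (f : ℕ → ℕ → ℕ) → ∑ m (λ i → ∑ n (f i)) ≡ ∑ n (λ j → ∑ m λ i → f i j)
∑²-comm m n f = ∑-comm {m} {n} λ i j → f (toℕ i) (toℕ j)

weight-blocks : ∀ N t A → weight (N * t) A ≡ ∑ N λ I → ∑ N λ J → weight t (block t A I J)
weight-blocks N t A = trans
  (∑-* N t λ i → ∑ (N * t) λ j → ι (A i j))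
  (∑-cong N λ I _ → trans
    (∑-cong t λ x _ → ∑-* N t (λ j → ι (A (I * t + x) j)))
    (∑²-comm t N λ x J → ∑ t λ y → ι (block t A I J x y)))

-- Compress each block of the block column `J` to one row recording which of its columns are
-- nonempty. The interval minor then consists of `suc l` blocks that all hit the same `suc l`
-- intervals. The block whose index is the preimage of `j` under π supplies the one-entry in
-- interval `j`; different blocks lie in different block rows, so the rows are ordered as well.
wideColumn⇒Copy : ∀ (π : Permutation′ (suc l)) m A J →
  Chain (λ I → 2 ^ l ≤ columnHits (2 ^ m) (block (2 ^ m) A I J)) 0 (suc l * 4 ^ m) → Copy π A
wideColumn⇒Copy {l} π m A J chain
  with cs , rows ← intervalMinor (λ I y → ⌊ columnHit? (2 ^ m) (block (2 ^ m) A I J) y ⌋)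
         {suc l} (s≤s z≤n) l m (λ wide → wide) chain
  with y , _ , y-incr , hits ← transversal
         (λ j y → ⌊ columnHit? (2 ^ m) (block (2 ^ m) A (chain-lookup rows (π ⟨$⟩ˡ j)) J) y ⌋)
         cs (λ j → proj₂ (chain-lookup-P rows (π ⟨$⟩ˡ j))) =
  (λ i → chain-lookup rows i * t + x (π ⟨$⟩ʳ i)) , (λ j → J * t + y j) ,
  (λ i<j → block-< (chain-lookup-< rows i<j) (proj₁ (proj₂ (hit _)))) ,
  (λ i<j → +-monoʳ-< (J * t) (y-incr i<j)) ,
  λ i → subst (λ j → T (A (chain-lookup rows j * t + x (π ⟨$⟩ʳ i)) (J * t + y (π ⟨$⟩ʳ i))))
          (inverseˡ π) (proj₂ (proj₂ (hit (π ⟨$⟩ʳ i))))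
  where
  t : ℕ
  t = 2 ^ m

  hit : ∀ j → _
  hit j = toWitness {a? = columnHit? t (block t A (chain-lookup rows (π ⟨$⟩ˡ j)) J) (y j)} (hits j)

  x : Fin (suc l) → ℕ
  x j = proj₁ (hit j)

wideCount : ∀ (π : Permutation′ (suc l)) m A → ¬ Copy π A → ∀ N J →
  ∑ N (λ I → ι ⌊ wide? (2 ^ l) (2 ^ m) (block (2 ^ m) A I J) ⌋) ≤ suc l * 4 ^ m
wideCount {l} π m A free N J = ≮⇒≥ λ large → free (wideColumn⇒Copy π m A J
  (chain-take (<⇒≤ large) (chain-filter (λ I → wide? (2 ^ l) (2 ^ m) (block (2 ^ m) A I J)) N)))

weight-recursion : ∀ (π : Permutation′ (suc l)) m A → ¬ Copy π A → ∀ N →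
  let s = 2 ^ l; t = 2 ^ m; q = suc l * 4 ^ m in
  weight (N * t) A ≤ s * s * weight N (contract t A) + (t * t * (N * q) + t * t * (N * q))
weight-recursion {l} π m A free N = begin
  weight (N * t) A
    ≡⟨ weight-blocks N t A ⟩
  (∑ N λ I → ∑ N λ J → weight t (block t A I J))
    ≤⟨ (∑-mono-≤ N λ I _ → ∑-mono-≤ N λ J _ → block-weight s t (block t A I J)) ⟩
  (∑ N λ I → ∑ N λ J → s * s * B I J + (t * t * W I J + t * t * V I J))
    ≡⟨ ∑²-+ (λ I J → s * s * B I J) (λ I J → t * t * W I J + t * t * V I J) ⟩
  ∑² (λ I J → s * s * B I J) + ∑² (λ I J → t * t * W I J + t * t * V I J)
    ≡⟨ cong₂ _+_ (∑²-* (s * s) B) (trans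
         (∑²-+ (λ I J → t * t * W I J) (λ I J → t * t * V I J))
         (cong₂ _+_ (∑²-* (t * t) W) (∑²-* (t * t) V))) ⟩
  s * s * ∑² B + (t * t * ∑² W + t * t * ∑² V)
    ≤⟨ +-monoʳ-≤ (s * s * ∑² B) (+-mono-≤ (*-monoʳ-≤ (t * t) W≤) (*-monoʳ-≤ (t * t) V≤)) ⟩
  s * s * weight N (contract t A) + (t * t * (N * q) + t * t * (N * q)) ∎
  where
  open ≤-Reasoning

  s t q : ℕ
  s = 2 ^ l
  t = 2 ^ m
  q = suc l * 4 ^ m

  B W V : ℕ → ℕ → ℕ
  B I J = ι ⌊ nonzero? t (block t A I J) ⌋
  W I J = ι ⌊ wide? s t (block t A I J) ⌋
  V I J = ι ⌊ wide? s t (flip (block t A I J)) ⌋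

  ∑² : (ℕ → ℕ → ℕ) → ℕ
  ∑² f = ∑ N λ I → ∑ N (f I)

  ∑²-+ : ∀ f g → ∑² (λ I J → f I J + g I J) ≡ ∑² f + ∑² g
  ∑²-+ f g = trans
    (∑-cong N λ I _ → ∑-distrib-+ {N} (f I ∘ toℕ) (g I ∘ toℕ))
    (∑-distrib-+ {N} (λ I → ∑ N (f (toℕ I))) (λ I → ∑ N (g (toℕ I))))

  ∑²-* : ∀ x f → ∑² (λ I J → x * f I J) ≡ x * ∑² f
  ∑²-* x f = sym (trans (*-distribˡ-sum x (λ I → ∑ N (f (toℕ {N} I))))
    (∑-cong N λ I _ → *-distribˡ-sum x (f I ∘ toℕ {N})))

  -- Wide blocks are bounded within each block column, so the sums are exchanged first. Tall blocks
  -- are bounded within each block row, through the transpose and the inverse of π.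
  W≤ : ∑² W ≤ N * q
  W≤ = ≤-trans (≤-reflexive (∑²-comm N N W)) (∑-≤-const N λ J _ → wideCount π m A free N J)

  V≤ : ∑² V ≤ N * q
  V≤ = ∑-≤-const N λ I _ → wideCount (Perm.flip π) m (flip A) (free ∘ Copy-flip π A) N I

-- The linear bound on the weight.

logBlock : ℕ → ℕ
logBlock l = suc (l + l)

linearConstant : ℕ → ℕ
linearConstant l = 2 ^ (logBlock l * 5)

n<2^n : ∀ n → n < 2 ^ n
n<2^n zero    = s≤s z≤n
n<2^n (suc n) = +-mono-≤ (m^n>0 2 n) (≤-trans (n<2^n n) (m≤m+n (2 ^ n) 0))

-- D = t⁵ with t = 2 s²: half of D * (N * t) pays for s² * (D * N), and the other
-- half for the 2 (l + 1) t⁴ N ones in wide or tall blocks.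
weight-step : ∀ l N w →
  let s = 2 ^ l; t = 2 ^ logBlock l; q = suc l * 4 ^ logBlock l; D = linearConstant l in
  w ≤ D * N → s * s * w + (t * t * (N * q) + t * t * (N * q)) ≤ D * (N * t)
weight-step l N w w≤ = begin
  s * s * w + (t * t * (N * q) + t * t * (N * q))  ≤⟨ +-monoˡ-≤ _ (*-monoʳ-≤ (s * s) w≤) ⟩
  s * s * (D * N) + (t * t * (N * q) + t * t * (N * q))
    ≡⟨ cong (λ x → s * s * (D * N) + (t * t * (N * (suc l * x)) + t * t * (N * (suc l * x)))) 4^≡ ⟩
  s * s * (D * N) + (t * t * (N * (suc l * (t * t))) + t * t * (N * (suc l * (t * t))))
    ≡⟨ cong (s * s * (D * N) +_) (lemma₁ t N (suc l)) ⟩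
  s * s * (D * N) + 2 * suc l * (t * t * t * t * N)
    ≤⟨ +-monoʳ-≤ (s * s * (D * N)) (*-monoˡ-≤ _ 2k≤sst) ⟩
  s * s * (D * N) + s * s * t * (t * t * t * t * N)
    ≡⟨ cong (λ x → s * s * (x * N) + s * s * t * (t * t * t * t * N)) D≡ ⟩
  s * s * (t ^ 5 * N) + s * s * t * (t * t * t * t * N)
    ≡⟨ lemma₂ (s * s) t N ⟩
  t ^ 5 * (N * (2 * (s * s)))
    ≡⟨ cong₂ (λ x y → x * (N * y)) (sym D≡) (sym t≡) ⟩
  D * (N * t) ∎
  where
  open ≤-Reasoning

  s t q D : ℕ
  s = 2 ^ l
  t = 2 ^ logBlock l
  q = suc l * 4 ^ logBlock l
  D = linearConstant l

  t≡ : t ≡ 2 * (s * s)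
  t≡ = cong (2 *_) (^-distribˡ-+-* 2 l l)

  4^≡ : 4 ^ logBlock l ≡ t * t
  4^≡ = trans (^-*-assoc 2 2 (logBlock l))
    (trans (cong (2 ^_) (cong (logBlock l +_) (+-identityʳ _)))
      (^-distribˡ-+-* 2 (logBlock l) (logBlock l)))

  D≡ : D ≡ t ^ 5
  D≡ = sym (^-*-assoc 2 (logBlock l) 5)

  2k≤sst : 2 * suc l ≤ s * s * t
  2k≤sst = ≤-trans (*-monoʳ-≤ 2 (≤-trans (n<2^n l) (m≤m*n s s)))
    (≤-trans (≤-reflexive (sym t≡)) (m≤n*m t (s * s)))
    where instance _ = m^n≢0 2 l
                   _ = m*n≢0 s s {{m^n≢0 2 l}} {{m^n≢0 2 l}}

  lemma₁ : ∀ t N k → t * t * (N * (k * (t * t))) + t * t * (N * (k * (t * t)))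
                   ≡ 2 * k * (t * t * t * t * N)
  lemma₁ = solve-∀

  lemma₂ : ∀ u t N → let t⁵ = t * (t * (t * (t * (t * 1)))) in
    u * (t⁵ * N) + u * t * (t * t * t * t * N) ≡ t⁵ * (N * (2 * u))
  lemma₂ = solve-∀

-- Strong induction over all avoiding grids at once, as the hypothesis is applied to a contraction.
-- With powers of 2 as sides, the block side divides every side that is not smaller; such sides are
-- cofinal, which suffices for a limit.
weight-linear : ∀ (π : Permutation′ (suc l)) A → ¬ Copy π A → ∀ i →
  weight (2 ^ i) A ≤ linearConstant l * 2 ^ i
weight-linear {l} π A free i = <-rec
  (λ i → ∀ A → ¬ Copy π A → weight (2 ^ i) A ≤ linearConstant l * 2 ^ i)
  step i A free
  where
  step : ∀ i → (∀ {j} → j < i → ∀ A → ¬ Copy π A → weight (2 ^ j) A ≤ linearConstant l * 2 ^ j) →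
    ∀ A → ¬ Copy π A → weight (2 ^ i) A ≤ linearConstant l * 2 ^ i
  step i rec A free with logBlock l ≤? i
  -- Below the block side the area is a good enough bound, because the side is then at most
  -- `linearConstant l`.
  ... | no m≰i = ≤-trans (weight-≤-square (2 ^ i) A) (*-monoˡ-≤ (2 ^ i)
          (^-monoʳ-≤ 2 (≤-trans (≰⇒≥ m≰i) (m≤m*n (logBlock l) 5))))
  ... | yes m≤i = subst (λ n → weight n A ≤ linearConstant l * n) 2^≡ (≤-trans
          (weight-recursion π (logBlock l) A free (2 ^ (i ∸ logBlock l)))
          (weight-step l (2 ^ (i ∸ logBlock l)) _
            (rec (∸-monoʳ-< {i} {logBlock l} {0} z<s m≤i) (contract (2 ^ logBlock l) A)
              (free ∘ Copy-contract π (2 ^ logBlock l) A))))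
    where
    2^≡ : 2 ^ (i ∸ logBlock l) * 2 ^ logBlock l ≡ 2 ^ i
    2^≡ = trans (sym (^-distribˡ-+-* 2 (i ∸ logBlock l) (logBlock l))) (cong (2 ^_) (m∸n+n≡m m≤i))

-- Counting by covers.

-- A cover of size c bounds by c the number of elements of P, up to having a common
-- code under R; unlike a cardinality it needs no decidability of P.
module _ {A X : Set} where

  record Cover (P : Pred A 0ℓ) (R : REL A X 0ℓ) (c : ℕ) : Set where
    constructor cover
    field
      elements : List X
      size     : length elements ≤ c
      covers   : ∀ {a} → P a → Any (R a) elements

open Cover

cover-≤ : c ≤ d → Cover P R c → Cover P R d
cover-≤ c≤d (cover xs size covers) = cover xs (≤-trans size c≤d) covers

cover-pullback : (h : A′ → A) → (∀ {a} → Q a → P (h a)) →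
  Cover P R c → Cover Q (R ∘ h) c
cover-pullback h Q⇒P (cover xs size covers) = cover xs size (covers ∘ Q⇒P)

cover-map : (h : X → Y) → (∀ {a x} → P a → R a x → R′ a (h x)) →
  Cover P R c → Cover P R′ c
cover-map h R⇒R′ (cover xs size covers) =
  cover (List.map h xs) (≤-trans (≤-reflexive (length-map h xs)) size)
    (λ Pa → Any.map⁺ (Any.map (R⇒R′ Pa) (covers Pa)))

cover-empty : (∀ {a} → ¬ P a) → Cover P R c
cover-empty ∄ = cover [] z≤n (λ Pa → contradiction Pa ∄)

-- The second code is chosen with the first one known, so `d` has to bound each fibre only.
cover-bind : Cover P R b → (∀ x → Cover (λ a → P a × R a x) R′ d) → Cover P R′ (b * d)
cover-bind {P = P} {R = R} {R′ = R′} {d = d} (cover xs size covers) next =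
  cover (concatMap (elements ∘ next) xs)
    (≤-trans (length-concatMap xs) (*-monoˡ-≤ d size))
    (λ Pa → Any.concatMap⁺ (elements ∘ next)
      (Any.map (λ Rax → Cover.covers (next _) (Pa , Rax)) (covers Pa)))
  where
  length-concatMap : ∀ xs → length (concatMap (elements ∘ next) xs) ≤ length xs * d
  length-concatMap []       = z≤n
  length-concatMap (x ∷ xs) = ≤-trans
    (≤-reflexive (length-++ (elements (next x))))
    (+-mono-≤ (Cover.size (next x)) (length-concatMap xs))

_◂_ : X → (ℕ → X) → ℕ → X
(x ◂ g) zero    = x
(x ◂ g) (suc i) = g i

-- The part of the bound that varies with `i` sits in an exponent, so that the product over `i`
-- becomes a sum of exponents, later the weight of a grid. The default `x₀` fills the code from `n`
-- on.
cover-Π : ∀ {X : Set} (x₀ : X) n {P : Pred A 0ℓ} {R : ℕ → REL A X 0ℓ} c b w →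
  (∀ i → i < n → Cover P (R i) (c * b ^ w i)) →
  Cover P (λ a (g : ℕ → X) → ∀ i → i < n → R i a (g i)) (c ^ n * b ^ ∑ n w)
cover-Π x₀ zero    c b w C = cover ((λ _ → x₀) ∷ []) (s≤s z≤n) λ _ → here λ _ ()
cover-Π x₀ (suc n) {P} {R} c b w C = cover-≤ (≤-reflexive size≡)
  (cover-bind (C 0 z<s) λ x →
    cover-map (x ◂_) (λ { (_ , R₀) Rg zero _ → R₀ ; _ Rg (suc i) i<n → Rg i (s<s⁻¹ i<n) })
      (cover-pullback (λ a → a) proj₁
        (cover-Π x₀ n c b (w ∘ suc) λ i i<n → C (suc i) (s<s i<n))))
  where
  size≡ : c * b ^ w 0 * (c ^ n * b ^ ∑ n (w ∘ suc)) ≡ c ^ suc n * b ^ ∑ (suc n) w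
  size≡ = trans (lemma c (b ^ w 0) (c ^ n) (b ^ ∑ n (w ∘ suc)))
    (cong (c * c ^ n *_) (sym (^-distribˡ-+-* b (w 0) (∑ n (w ∘ suc)))))
    where
    lemma : ∀ c x d y → c * x * (d * y) ≡ c * d * (x * y)
    lemma = solve-∀

support : ℕ → (ℕ → Bool) → List ℕ
support zero    f = []
support (suc n) f = if f 0 then 0 ∷ rest else rest
  where rest = List.map suc (support n (f ∘ suc))

length-support : ∀ n f → length (support n f) ≡ ∑ n (ι ∘ f)
length-support zero    f = refl
length-support (suc n) f with f 0
... | true  = cong suc (trans (length-map suc (support n (f ∘ suc))) (length-support n (f ∘ suc)))
... | false = trans (length-map suc (support n (f ∘ suc))) (length-support n (f ∘ suc))

∈-support : ∀ n f {x} → x < n → T (f x) → Any (x ≡_) (support n f)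
∈-support (suc n) f {zero} _ f0 with f 0
... | true = here refl
∈-support (suc n) f {suc x} x<n fx
  with f 0 | Any.map⁺ {f = suc} (Any.map (cong suc) (∈-support n (f ∘ suc) (s<s⁻¹ x<n) fx))
... | true  | x∈ = there x∈
... | false | x∈ = x∈

cover-support : ∀ n f (g : A → ℕ) → (∀ {a} → P a → g a < n × T (f (g a))) →
  Cover P (λ a x → g a ≡ x) (∑ n (ι ∘ f))
cover-support n f g bounds = cover (support n f) (≤-reflexive (length-support n f))
  λ Pa → ∈-support n f (proj₁ (bounds Pa)) (proj₂ (bounds Pa))

cover-Bool : (g : A → Bool) → Cover P (λ a x → g a ≡ x) 2
cover-Bool g = cover (false ∷ true ∷ []) ≤-refl λ {a} _ → membership (g a)
  where
  membership : ∀ x → Any (x ≡_) (false ∷ true ∷ [])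
  membership false = here refl
  membership true  = there (here refl)

-- Klazar's refinement: covering the grids that avoid π.

Agree : ℕ → Grid → Grid → Set
Agree n A B = ∀ i j → i < n → j < n → A i j ≡ B i j

Agree⇒weight≡ : ∀ n {A B} → Agree n A B → weight n A ≡ weight n B
Agree⇒weight≡ n A≡B = ∑-cong n λ i i<n → ∑-cong n λ j j<n → cong ι (A≡B i j i<n j<n)

¬T⇒≡false : ∀ {x} → ¬ T x → x ≡ false
¬T⇒≡false {false} _  = refl
¬T⇒≡false {true}  ¬t = contradiction tt ¬t

contract-zero : ∀ t A I J → contract t A I J ≡ false → ∀ {x y} → x < t → y < t →
  A (I * t + x) (J * t + y) ≡ false
contract-zero t A I J eq {x} {y} x<t y<t = ¬T⇒≡false λ one →
  subst T eq (fromWitness {a? = nonzero? t (block t A I J)} (x , x<t , y , y<t , one))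

i≡i/t*t+i%t : ∀ i t .{{_ : NonZero t}} → i ≡ i / t * t + i % t
i≡i/t*t+i%t i t = trans (m≡m%n+[m/n]*n i t) (+-comm (i % t) _)

-- A zero of `B` forces a zero block, while a one leaves at most `2 ^ 4` contents for its 2 × 2
-- block.
cover-refinements : ∀ N B → Cover (λ A → Agree N (contract 2 A) B) (Agree (N * 2)) (16 ^ weight N B)
cover-refinements N B = cover-map reassemble agree
  (cover-≤ (≤-reflexive (1^*≡ N))
    (cover-Π (λ _ _ _ → false) N 1 16 (λ I → ∑ N (ι ∘ B I)) λ I I<N →
      cover-≤ (≤-reflexive (trans (1^*≡ N) (sym (*-identityˡ _))))
        (cover-Π (λ _ _ → false) N 1 16 (ι ∘ B I) λ J J<N → blocks I J I<N J<N)))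
  where
  1^*≡ : ∀ n {x} → 1 ^ n * x ≡ x
  1^*≡ n {x} = trans (cong (_* x) (^-zeroˡ n)) (*-identityˡ x)

  BlockAgree : ℕ → ℕ → Grid → Grid → Set
  BlockAgree I J A q = ∀ x → x < 2 → ∀ y → y < 2 → block 2 A I J x y ≡ q x y

  blocks : ∀ I J → I < N → J < N →
    Cover (λ A → Agree N (contract 2 A) B) (BlockAgree I J) (1 * 16 ^ ι (B I J))
  blocks I J I<N J<N with B I J in eq
  -- Each of the two rows has `2 ^ 2` contents; with all exponents 0 the bound is `4 ^ 2`.
  ... | true  = cover-Π (λ _ → false) 2 4 16 (λ _ → 0) λ x _ →
                  cover-Π false 2 2 16 (λ _ → 0) λ y _ →
                    cover-Bool (λ A → block 2 A I J x y)
  ... | false = cover ((λ _ _ → false) ∷ []) ≤-refl λ {A} agr → here λ x x<2 y y<2 →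
                  contract-zero 2 A I J (trans (agr I J I<N J<N) eq) x<2 y<2

  reassemble : (ℕ → ℕ → Grid) → Grid
  reassemble g i j = g (i / 2) (j / 2) (i % 2) (j % 2)

  agree : ∀ {A g} → Agree N (contract 2 A) B →
    (∀ I → I < N → ∀ J → J < N → BlockAgree I J A (g I J)) → Agree (N * 2) A (reassemble g)
  agree {A} _ blocksAgree i j i<2N j<2N = trans
    (cong₂ A (i≡i/t*t+i%t i 2) (i≡i/t*t+i%t j 2))
    (blocksAgree (i / 2) (m<n*o⇒m/o<n i<2N) (j / 2) (m<n*o⇒m/o<n j<2N)
      (i % 2) (m%n<n i 2) (j % 2) (m%n<n j 2))

-- Contracting 2 × 2 blocks halves the side, and at most D * N of the blocks have to
-- be refined, so the exponents add up geometrically.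
cover-avoiders : ∀ (π : Permutation′ (suc l)) i →
  Cover (λ A → ¬ Copy π A) (Agree (2 ^ i)) (16 ^ (linearConstant l * 2 ^ i))
cover-avoiders {l} π zero = cover-≤ 2≤16^
  (cover-map (λ x _ _ → x)
    (λ { _ A≡x zero    zero    _        _        → A≡x
       ; _ _   (suc _) _       (s≤s ()) _
       ; _ _   zero    (suc _) _        (s≤s ()) })
    (cover-Bool λ A → A 0 0))
  where
  2≤16^ : 2 ≤ 16 ^ (linearConstant l * 1)
  2≤16^ = ≤-trans (m≤m+n 2 14) (^-monoʳ-≤ 16 {1} (≤-trans (m^n>0 2 (logBlock l * 5)) (m≤m*n _ 1)))
cover-avoiders {l} π (suc i) = subst
  (λ n → Cover (λ A → ¬ Copy π A) (Agree n) (16 ^ (D * n))) (*-comm N 2)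
  (cover-≤ (≤-reflexive size≡)
    (cover-bind (cover-pullback (contract 2) (λ {A} → avoids A) (cover-avoiders π i))
      λ B → refinements B (weight N B ≤? D * N)))
  where
  D N : ℕ
  D = linearConstant l
  N = 2 ^ i

  avoids : ∀ A → ¬ Copy π A → ¬ Copy π (contract 2 A)
  avoids A free = free ∘ Copy-contract π 2 A

  refinements : ∀ B → Dec (weight N B ≤ D * N) →
    Cover (λ A → ¬ Copy π A × Agree N (contract 2 A) B) (Agree (N * 2)) (16 ^ (D * N))
  refinements B (yes w≤) = cover-pullback (λ A → A) proj₂
    (cover-≤ (^-monoʳ-≤ 16 w≤) (cover-refinements N B))
  -- The list of codes may contain grids that are too heavy; by the linear bound no avoiding grid
  -- contracts to one of these.
  refinements B (no w≰)  = cover-empty λ {A} (free , agr) →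
    w≰ (subst (_≤ D * N) (Agree⇒weight≡ N agr) (weight-linear π (contract 2 A) (avoids A free) i))

  size≡ : 16 ^ (D * N) * 16 ^ (D * N) ≡ 16 ^ (D * (N * 2))
  size≡ = trans (sym (^-distribˡ-+-* 16 (D * N) (D * N))) (cong (16 ^_) (lemma D N))
    where
    lemma : ∀ x y → x * y + x * y ≡ x * (y * 2)
    lemma = solve-∀

-- Estimates for powers.

^-distribʳ-* : ∀ n x y → (x * y) ^ n ≡ x ^ n * y ^ n
^-distribʳ-* zero    x y = refl
^-distribʳ-* (suc n) x y = trans (cong (x * y *_) (^-distribʳ-* n x y)) (lemma x y (x ^ n) (y ^ n))
  where
  lemma : ∀ x y z w → x * y * (z * w) ≡ x * z * (y * w)
  lemma = solve-∀

-- Takes the place of AM-GM in bounding the product of the row weights.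
w^t≤t^t*2^w : ∀ w t .{{_ : NonZero t}} → w ^ t ≤ t ^ t * 2 ^ w
w^t≤t^t*2^w w t = begin
  w ^ t                      ≤⟨ ^-monoˡ-≤ t w≤ ⟩
  (t * 2 ^ (w / t)) ^ t      ≡⟨ ^-distribʳ-* t t (2 ^ (w / t)) ⟩
  t ^ t * (2 ^ (w / t)) ^ t  ≡⟨ cong (t ^ t *_) (^-*-assoc 2 (w / t) t) ⟩
  t ^ t * 2 ^ (w / t * t)    ≤⟨ *-monoʳ-≤ (t ^ t) (^-monoʳ-≤ 2 (m/n*n≤m w t)) ⟩
  t ^ t * 2 ^ w              ∎
  where
  open ≤-Reasoning

  w≤ : w ≤ t * 2 ^ (w / t)
  w≤ = begin
    w                      ≡⟨ m≡m%n+[m/n]*n w t ⟩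
    w % t + w / t * t      ≤⟨ +-monoˡ-≤ _ (<⇒≤ (m%n<n w t)) ⟩
    suc (w / t) * t        ≡⟨ *-comm (suc (w / t)) t ⟩
    t * suc (w / t)        ≤⟨ *-monoʳ-≤ t (n<2^n (w / t)) ⟩
    t * 2 ^ (w / t)        ∎

-- From copies in grids to containment of matrices and permutations.

at : A → Vec A n → ℕ → A
at d []       _       = d
at d (x ∷ v) zero    = x
at d (x ∷ v) (suc i) = at d v i

at-cases : ∀ (d : A) (v : Vec A n) i → at d v i ≡ d ⊎ (∃[ j ] toℕ j ≡ i × lookup v j ≡ at d v i)
at-cases d []      i    = inj₁ refl
at-cases d (x ∷ v) zero = inj₂ (zero , refl , refl)
at-cases d (x ∷ v) (suc i) with at-cases d v i
... | inj₁ eq              = inj₁ eq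
... | inj₂ (j , j≡i , eq) = inj₂ (suc j , cong suc j≡i , eq)

at-replicate : ∀ n (d : A) i → at d (replicate n d) i ≡ d
at-replicate zero    d i       = refl
at-replicate (suc n) d zero    = refl
at-replicate (suc n) d (suc i) = at-replicate n d i

lookup≡at : ∀ (d : A) (v : Vec A n) j → lookup v j ≡ at d v (toℕ j)
lookup≡at d (x ∷ v) zero    = refl
lookup≡at d (x ∷ v) (suc j) = lookup≡at d v j

grid : Matrix m n → Grid
grid {n = n} A i j = at false (at (replicate n false) A i) j

entry≡grid : ∀ (A : Matrix m n) i j → entry A i j ≡ grid A (toℕ i) (toℕ j)
entry≡grid {n = n} A i j = trans (lookup≡at false (lookup A i) j)
  (cong (λ row → at false row (toℕ j)) (lookup≡at (replicate n false) A i))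

grid-one : ∀ (A : Matrix m n) {i j} → T (grid A i j) →
  ∃[ i′ ] ∃[ j′ ] toℕ i′ ≡ i × toℕ j′ ≡ j × entry A i′ j′ ≡ true
grid-one {n = n} A {i} {j} one
  with at-cases (replicate n false) A i | at-cases false (at (replicate n false) A i) j
... | _ | inj₁ eq = contradiction (subst T eq one) λ ()
... | inj₁ eq | inj₂ _ = contradiction
  (subst T (trans (cong (λ row → at false row j) eq) (at-replicate n false j)) one) λ ()
... | inj₂ (i′ , i′≡i , row≡) | inj₂ (j′ , j′≡j , eq) = i′ , j′ , i′≡i , j′≡j ,
  trans (cong (λ row → lookup row j′) row≡) (trans eq (Equivalence.to T-≡ one))

mass≡weight : ∀ (A : Matrix n n) → mass A ≡ weight n (grid A)
mass≡weight {n} = rows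
  where
  row : ∀ {m} (v : Vec Bool m) → count (Bool._≟ true) v ≡ ∑ m λ j → ι (at false v j)
  row []          = refl
  row (true  ∷ v) = cong suc (row v)
  row (false ∷ v) = row v

  rows : ∀ {m} (A : Matrix m n) → mass A ≡ ∑ m λ i → ∑ n λ j → ι (grid A i j)
  rows []      = refl
  rows (v ∷ A) = cong₂ _+_ (row v) (rows A)

IncreasingFin : (Fin k → Fin n) → Set
IncreasingFin f = ∀ {i j} → i Fin.< j → f i Fin.< f j

-- A common intermediate form, from which containment of matrices and containment of permutations
-- both follow.
FinCopy : Permutation′ k → Matrix m n → Set
FinCopy {k} {m} {n} π A = ∃[ r ] ∃[ c ] IncreasingFin {k} {m} r × IncreasingFin {k} {n} c ×
  (∀ i → entry A (r i) (c (π ⟨$⟩ʳ i)) ≡ true)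

Copy⇒FinCopy : ∀ (π : Permutation′ k) (A : Matrix m n) → Copy π (grid A) → FinCopy π A
Copy⇒FinCopy π A (r , c , r-incr , c-incr , ones) =
  proj₁ ∘ cell , (λ j → proj₁ (proj₂ (cell (π ⟨$⟩ˡ j)))) ,
  (λ {i} {j} i<j → subst₂ _<_ (sym (row≡ i)) (sym (row≡ j)) (r-incr i<j)) ,
  (λ {i} {j} i<j → subst₂ _<_ (sym (column≡ i)) (sym (column≡ j)) (c-incr i<j)) ,
  λ i → subst (λ j → entry A (proj₁ (cell i)) (proj₁ (proj₂ (cell j))) ≡ true) (sym (inverseˡ π))
          (proj₂ (proj₂ (proj₂ (proj₂ (cell i)))))
  where
  cell : ∀ i → _
  cell i = grid-one A (ones i)

  row≡ : ∀ i → toℕ (proj₁ (cell i)) ≡ r i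
  row≡ i = proj₁ (proj₂ (proj₂ (cell i)))

  column≡ : ∀ j → toℕ (proj₁ (proj₂ (cell (π ⟨$⟩ˡ j)))) ≡ c j
  column≡ j = trans (proj₁ (proj₂ (proj₂ (proj₂ (cell (π ⟨$⟩ˡ j)))))) (cong c (inverseʳ π))

entry-permutationMatrix : ∀ (σ : Permutation′ n) i j →
  entry (permutationMatrix σ) i j ≡ does (σ ⟨$⟩ʳ i Fin.≟ j)
entry-permutationMatrix σ i j =
  trans (cong (λ row → lookup row j) (lookup∘tabulate _ i)) (lookup∘tabulate _ j)

entry-true : ∀ (σ : Permutation′ n) i j → entry (permutationMatrix σ) i j ≡ true → σ ⟨$⟩ʳ i ≡ j
entry-true σ i j eq with σ ⟨$⟩ʳ i Fin.≟ j | entry-permutationMatrix σ i j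
... | yes σi≡j | _   = σi≡j
... | no  _    | eq′ = contradiction (trans (sym eq) eq′) λ ()

tabulate-increasing : ∀ {f : Fin k → Fin n} → IncreasingFin f → Increasing (tabulate f)
tabulate-increasing {f = f} f-incr i j i<j =
  subst₂ Fin._<_ (sym (lookup∘tabulate f i)) (sym (lookup∘tabulate f j)) (f-incr i<j)

FinCopy⇒Containsᴹ : ∀ (π : Permutation′ k) (A : Matrix m n) →
  FinCopy π A → A Containsᴹ permutationMatrix π
FinCopy⇒Containsᴹ π A (r , c , r-incr , c-incr , ones) =
  tabulate r , tabulate c , tabulate-increasing r-incr , tabulate-increasing c-incr , λ i j one →
    trans (cong₂ (entry A) (lookup∘tabulate r i)
            (trans (lookup∘tabulate c j) (cong c (sym (entry-true π i j one)))))
          (ones i)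

-- The one-entries say that σ maps `r i` to `c (π ⟨$⟩ʳ i)`, and a strictly increasing `c` both
-- preserves and reflects the order.
FinCopy⇒Contains : ∀ (π : Permutation′ k) (σ : Permutation′ n) →
  FinCopy π (permutationMatrix σ) → σ Contains π
FinCopy⇒Contains π σ (r , c , r-incr , c-incr , ones) =
  tabulate r , tabulate-increasing r-incr , λ i j → mk⇔
    (λ σ< → cancel (subst₂ Fin._<_ (σr≡ i) (σr≡ j) σ<))
    (λ π< → subst₂ Fin._<_ (sym (σr≡ i)) (sym (σr≡ j)) (c-incr π<))
  where
  σr≡ : ∀ i → σ ⟨$⟩ʳ lookup (tabulate r) i ≡ c (π ⟨$⟩ʳ i)
  σr≡ i = trans (cong (σ ⟨$⟩ʳ_) (lookup∘tabulate r i)) (entry-true σ (r i) _ (ones i))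

  cancel : ∀ {i j} → c i Fin.< c j → i Fin.< j
  cancel {i} {j} ci<cj with <-cmp (toℕ i) (toℕ j)
  ... | tri< i<j _ _ = i<j
  ... | tri≈ _ i≡j _ = contradiction ci<cj (<-irrefl (cong (toℕ ∘ c) (Fin.toℕ-injective i≡j)))
  ... | tri> _ _ j<i = contradiction ci<cj (<-asym (c-incr j<i))

ex-linear : ∀ (π : Permutation′ (suc l)) i → ex (2 ^ i) π ≤ linearConstant l * 2 ^ i
ex-linear {l} π i with A , avoids , mass≡ ← ex-attained (2 ^ i) π =
  subst (_≤ linearConstant l * 2 ^ i) (trans (sym (mass≡weight A)) mass≡)
    (weight-linear π (grid A) (avoids ∘ FinCopy⇒Containsᴹ π A ∘ Copy⇒FinCopy π A) i)

-- Permutations with a given contraction.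

permutationGrid : Permutation′ n → Grid
permutationGrid σ = grid (permutationMatrix σ)

permutationGrid-one : ∀ (σ : Permutation′ n) i → T (permutationGrid σ (toℕ i) (toℕ (σ ⟨$⟩ʳ i)))
permutationGrid-one σ i = subst T (entry≡grid (permutationMatrix σ) i (σ ⟨$⟩ʳ i))
  (Equivalence.from T-≡ (trans (entry-permutationMatrix σ i (σ ⟨$⟩ʳ i))
    (dec-true (σ ⟨$⟩ʳ i Fin.≟ σ ⟨$⟩ʳ i) refl)))

avoids⇒free : ∀ (π : Permutation′ k) (σ : Permutation′ n) →
  σ Avoids π → ¬ Copy π (permutationGrid σ)
avoids⇒free π σ avoids = avoids ∘ FinCopy⇒Contains π σ ∘ Copy⇒FinCopy π (permutationMatrix σ)

module _ (N t : ℕ) .{{_ : NonZero t}} where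

  Contracts : Grid → Permutation′ (N * t) → Set
  Contracts B σ = Agree N (contract t (permutationGrid σ)) B

  -- The position is matched through `toℕ z`, so that no proof of its being in range is carried
  -- along.
  ValuesAt : ℕ → ℕ → Permutation′ (N * t) → ℕ → Set
  ValuesAt I x σ y = ∀ z → toℕ z ≡ I * t + x → toℕ (σ ⟨$⟩ʳ z) ≡ y

  Values : Permutation′ (N * t) → (ℕ → ℕ → ℕ) → Set
  Values σ g = ∀ I → I < N → ∀ x → x < t → ValuesAt I x σ (g I x)

  Values-injective : ∀ {σ τ g} → Values σ g → Values τ g → σ Perm.≈ τ
  Values-injective {σ} {τ} σg τg z = Fin.toℕ-injective (trans (value {σ} σg) (sym (value {τ} τg)))
    where
    value : ∀ {σ g} → Values σ g → toℕ (σ ⟨$⟩ʳ z) ≡ g (toℕ z / t) (toℕ z % t)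
    value σg = σg _ (m<n*o⇒m/o<n (Fin.toℕ<n z)) _ (m%n<n (toℕ z) t) z (i≡i/t*t+i%t (toℕ z) t)

  contract-one : ∀ {B σ} → Contracts B σ → ∀ z →
    T (B (toℕ z / t) (toℕ (σ ⟨$⟩ʳ z) / t))
  contract-one {B} {σ} agr z = subst T
    (agr _ _ (m<n*o⇒m/o<n (Fin.toℕ<n z)) (m<n*o⇒m/o<n (Fin.toℕ<n (σ ⟨$⟩ʳ z))))
    (fromWitness {a? = nonzero? t (block t (permutationGrid σ) (toℕ z / t) (toℕ (σ ⟨$⟩ʳ z) / t))}
      (toℕ z % t , m%n<n (toℕ z) t , toℕ (σ ⟨$⟩ʳ z) % t , m%n<n (toℕ (σ ⟨$⟩ʳ z)) t ,
        subst₂ (λ i j → T (permutationGrid σ i j))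
          (i≡i/t*t+i%t (toℕ z) t) (i≡i/t*t+i%t (toℕ (σ ⟨$⟩ʳ z)) t) (permutationGrid-one σ z)))

  -- The value at position I * t + x is fixed by its block column, one of the
  -- ones in row I of B, and by its residue modulo t.
  cover-value : ∀ B I x → I < N → x < t →
    Cover (Contracts B) (ValuesAt I x) (∑ N (ι ∘ B I) * t)
  cover-value B I x I<N x<t = cover-bind
    (cover-support N (B I) (λ σ → value σ / t) λ {σ} agr →
      m<n*o⇒m/o<n (Fin.toℕ<n (σ ⟨$⟩ʳ z)) ,
      subst (λ J → T (B J (value σ / t))) z/t≡ (contract-one {σ = σ} agr z))
    λ J → cover-map (J * t +_)
      (λ { {σ} (_ , refl) refl z′ z′≡ → trans
             (cong (λ z → toℕ (σ ⟨$⟩ʳ z)) (Fin.toℕ-injective (trans z′≡ (sym toℕ-z))))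
             (i≡i/t*t+i%t (value σ) t) })
      (cover-≤ (≤-trans (∑-≤-const t λ _ _ → ≤-refl) (≤-reflexive (*-identityʳ t)))
        (cover-support t (λ _ → true) (λ σ → value σ % t) λ {σ} _ → m%n<n (value σ) t , tt))
    where
    z : Fin (N * t)
    z = fromℕ< (<-≤-trans (block-< {y = 0} I<N x<t) (≤-reflexive (+-identityʳ (N * t))))

    toℕ-z : toℕ z ≡ I * t + x
    toℕ-z = Fin.toℕ-fromℕ< _

    value : Permutation′ (N * t) → ℕ
    value σ = toℕ (σ ⟨$⟩ʳ z)

    z/t≡ : toℕ z / t ≡ I
    z/t≡ = trans (cong (_/ t) toℕ-z) (trans (+-distrib-/-∣ˡ x (divides-refl I))
      (trans (cong₂ _+_ (m*n/n≡m I t) (m<n⇒m/n≡0 x<t)) (+-identityʳ I)))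

  -- A row of `B` with `w` ones leaves at most `(w * t) ^ t` choices for its `t` values. Bounding
  -- `w ^ t` by `t ^ t * 2 ^ w` makes the product over the rows depend on the total weight alone,
  -- which is at most the size of the permutation.
  cover-permutations : ∀ B → weight N B ≤ t * N →
    Cover (Contracts B) Values ((t * t * 2) ^ (N * t))
  cover-permutations B w≤ = cover-≤ total
    (cover-Π (λ _ → 0) N ((t * t) ^ t) 2 (λ I → ∑ N (ι ∘ B I)) λ I I<N →
      cover-≤ (row I)
        (cover-Π 0 t (∑ N (ι ∘ B I) * t) 1 (λ _ → 0) λ x x<t →
          cover-≤ (≤-reflexive (sym (*-identityʳ _))) (cover-value B I x I<N x<t)))
    where
    open ≤-Reasoning

    row : ∀ I → let w = ∑ N (ι ∘ B I) in (w * t) ^ t * 1 ^ ∑ t (λ _ → 0) ≤ (t * t) ^ t * 2 ^ w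
    row I = begin
      (w * t) ^ t * 1 ^ ∑ t (λ _ → 0)  ≡⟨ cong ((w * t) ^ t *_) (^-zeroˡ (∑ t λ _ → 0)) ⟩
      (w * t) ^ t * 1                  ≡⟨ *-identityʳ _ ⟩
      (w * t) ^ t                      ≡⟨ ^-distribʳ-* t w t ⟩
      w ^ t * t ^ t                    ≤⟨ *-monoˡ-≤ (t ^ t) (w^t≤t^t*2^w w t) ⟩
      t ^ t * 2 ^ w * t ^ t            ≡⟨ lemma (t ^ t) (2 ^ w) ⟩
      t ^ t * t ^ t * 2 ^ w            ≡⟨ cong (_* 2 ^ w) (sym (^-distribʳ-* t t t)) ⟩
      (t * t) ^ t * 2 ^ w              ∎
      where
      w : ℕ
      w = ∑ N (ι ∘ B I)

      lemma : ∀ x y → x * y * x ≡ x * x * y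
      lemma = solve-∀

    total : ((t * t) ^ t) ^ N * 2 ^ weight N B ≤ (t * t * 2) ^ (N * t)
    total = begin
      ((t * t) ^ t) ^ N * 2 ^ weight N B  ≤⟨ *-monoʳ-≤ (((t * t) ^ t) ^ N) (^-monoʳ-≤ 2 w≤) ⟩
      ((t * t) ^ t) ^ N * 2 ^ (t * N)     ≡⟨ cong (_* 2 ^ (t * N)) (^-*-assoc (t * t) t N) ⟩
      (t * t) ^ (t * N) * 2 ^ (t * N)     ≡⟨ sym (^-distribʳ-* (t * N) (t * t) 2) ⟩
      (t * t * 2) ^ (t * N)               ≡⟨ cong ((t * t * 2) ^_) (*-comm t N) ⟩
      (t * t * 2) ^ (N * t)               ∎

-- From covers to the number of avoiding permutations.

module _ (S : Setoid 0ℓ 0ℓ) where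
  open Setoid S using (Carrier; _≈_)

  lookup-unique : ∀ {xs} → Unique S xs → ∀ {i j} → List.lookup xs i ≈ List.lookup xs j → i ≡ j
  lookup-unique (x∉ ∷ u) {zero}  {zero}  _  = refl
  lookup-unique (x∉ ∷ u) {zero}  {suc j} eq = contradiction eq (All.lookup x∉ (∈-lookup j))
  lookup-unique (x∉ ∷ u) {suc i} {zero}  eq =
    contradiction (Setoid.sym S eq) (All.lookup x∉ (∈-lookup i))
  lookup-unique (x∉ ∷ u) {suc i} {suc j} eq = cong suc (lookup-unique u eq)

  -- A common code makes two elements equal in the setoid, so sending a list position to the index
  -- of a code for its element is injective.
  unique-length-≤ : ∀ {P : Pred Carrier 0ℓ} {X : Set} {R : REL Carrier X 0ℓ} {c xs} →
    (∀ {a b x} → R a x → R b x → a ≈ b) → Cover P R c → Unique S xs → All P xs → length xs ≤ c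
  unique-length-≤ {R = R} {xs = xs} R-inj (cover ys size covers) u all =
    ≤-trans (Fin.injective⇒≤ {f = Any.index ∘ found} injective) size
    where
    found : ∀ i → Any (R (List.lookup xs i)) ys
    found i = covers (All.lookup all (∈-lookup i))

    injective : ∀ {i j} → Any.index (found i) ≡ Any.index (found j) → i ≡ j
    injective {i} {j} eq = lookup-unique u (R-inj (Any.lookup-index (found i))
      (subst (λ y → R (List.lookup xs j) (List.lookup ys y)) (sym eq) (Any.lookup-index (found j))))

-- Per point of the permutation, 16 accounts for the choice of the contraction and the other factor
-- for the permutations above it.
growthConstant : ℕ → ℕ
growthConstant l = 16 * (linearConstant l * linearConstant l * 2)

-- With block side `linearConstant l` the contraction has side `2 ^ i`, and the linear bound on its
-- weight is exactly `n`.
S-exponential : ∀ (π : Permutation′ (suc l)) i → let n = 2 ^ i * linearConstant l in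
  S n π ≤ growthConstant l ^ n
S-exponential {l} π i = ≤-trans
  (unique-length-≤ (permutationSetoid (N * D)) (λ {σ} {τ} → Values-injective N D {σ} {τ})
    (cover-bind
      (cover-pullback (contract D ∘ permutationGrid) (λ {σ} → contracted σ) (cover-avoiders π i))
      (λ B → refine B (weight N B ≤? D * N)))
    (Unique.filter⁺ (permutationSetoid (N * D)) (avoids? π) (permutations-unique (N * D)))
    (All.all-filter (avoids? π) (permutations (N * D))))
  (≤-reflexive (trans (cong (λ e → 16 ^ e * (D * D * 2) ^ (N * D)) (*-comm D N))
    (sym (^-distribʳ-* (N * D) 16 (D * D * 2)))))
  where
  N D : ℕ
  N = 2 ^ i
  D = linearConstant l

  instance
    D≢0 : NonZero D
    D≢0 = m^n≢0 2 (logBlock l * 5)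

  contracted : ∀ σ → σ Avoids π → ¬ Copy π (contract D (permutationGrid σ))
  contracted σ avoids = avoids⇒free π σ avoids ∘ Copy-contract π D (permutationGrid σ)

  refine : ∀ B → Dec (weight N B ≤ D * N) →
    Cover (λ σ → σ Avoids π × Contracts N D B σ) (Values N D) ((D * D * 2) ^ (N * D))
  refine B (yes w≤) = cover-pullback id proj₂ (cover-permutations N D B w≤)
  refine B (no w≰)  = cover-empty λ {σ} (avoids , agr) →
    w≰ (subst (_≤ D * N) (Agree⇒weight≡ N agr)
      (weight-linear π (contract D (permutationGrid σ)) (contracted σ avoids) i))

-- Limits and bounds in the reals.

-- If some `q ≥ y` lay below `x`, so would a larger `q′`, and convergence with ε = `q′ - q` would
-- put `q` below `u n` for all large `n`. A cofinal set of indices is enough to refute this.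
limit-≤ᴿ : ∀ (u : (n : ℕ) .{{_ : NonZero n}} → ℝ) x y → u ⟶ x →
  (∀ N → Σ[ n ∈ ℕ ] Σ[ n≢0 ∈ NonZero n ] N ≤ n × u n {{n≢0}} ≤ᴿ fromℚ y) → x ≤ᴿ fromℚ y
limit-≤ᴿ u x y u⟶x cofinal q q∈x with q ℚ.<? y
... | yes q<y = q<y
... | no  q≮y
  with q′ , q<q′ , q′∈x ← ℝ.lower-open x q∈x
  with N , close ← u⟶x (q′ ℚ.- q)
         (subst (ℚ._< q′ ℚ.- q) (ℚ.+-inverseʳ q) (ℚ.+-monoˡ-< (ℚ.- q) q<q′))
  with n , n≢0 , N≤n , un≤y ← cofinal N
  with p , x<p , p-ε∈un ← proj₂ (close n {{n≢0}} N≤n) =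
  contradiction (ℚ.≤-<-trans q≤p-ε (un≤y _ p-ε∈un)) q≮y
  where
  q′≤p : q′ ℚ.≤ p
  q′≤p = ℚ.≮⇒≥ λ p<q′ → ℝ.disjoint x (ℝ.lower-closed x p<q′ q′∈x , x<p)

  cancel : ∀ q q′ → q′ ℚ.- (q′ ℚ.- q) ≡ q
  cancel = solve 2 (λ q q′ → q′ :- (q′ :- q) := q) refl
    where open +-*-Solver

  q≤p-ε : q ℚ.≤ p ℚ.- (q′ ℚ.- q)
  q≤p-ε = subst (ℚ._≤ p ℚ.- (q′ ℚ.- q)) (cancel q q′) (ℚ.+-monoˡ-≤ (ℚ.- (q′ ℚ.- q)) q′≤p)

/-≤-/1 : ∀ a b n .{{_ : NonZero n}} → a ≤ b * n → ℤ.+ a ℚ./ n ℚ.≤ ℤ.+ b ℚ./ 1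
/-≤-/1 a b (suc n) a≤bn = ℚ.toℚᵘ-cancel-≤ (ℚᵘ.≤-respʳ-≃ (ℚᵘ.≃-sym (ℚ.toℚᵘ-fromℚᵘ (mkℚᵘ (ℤ.+ b) 0)))
  (ℚᵘ.≤-respˡ-≃ (ℚᵘ.≃-sym (ℚ.toℚᵘ-fromℚᵘ (mkℚᵘ (ℤ.+ a) n)))
    (*≤* (subst₂ ℤ._≤_ (ℤ.pos-* a 1) (ℤ.pos-* b (suc n))
      (ℤ.+≤+ (≤-trans (≤-reflexive (*-identityʳ a)) a≤bn))))))

/1-* : ∀ a b → ℤ.+ (a * b) ℚ./ 1 ≡ (ℤ.+ a ℚ./ 1) ℚ.* (ℤ.+ b ℚ./ 1)
/1-* a b = ℚ.toℚᵘ-injective (begin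
  toℚᵘ (ℤ.+ (a * b) ℚ./ 1)
    ≈⟨ ℚ.toℚᵘ-fromℚᵘ (mkℚᵘ (ℤ.+ (a * b)) 0) ⟩
  mkℚᵘ (ℤ.+ (a * b)) 0
    ≡⟨ cong (λ i → mkℚᵘ i 0) (ℤ.pos-* a b) ⟩
  mkℚᵘ (ℤ.+ a) 0 ℚᵘ.* mkℚᵘ (ℤ.+ b) 0
    ≈⟨ ℚᵘ.*-cong (ℚᵘ.≃-sym (ℚ.toℚᵘ-fromℚᵘ (mkℚᵘ (ℤ.+ a) 0)))
         (ℚᵘ.≃-sym (ℚ.toℚᵘ-fromℚᵘ (mkℚᵘ (ℤ.+ b) 0))) ⟩
  toℚᵘ (ℤ.+ a ℚ./ 1) ℚᵘ.* toℚᵘ (ℤ.+ b ℚ./ 1)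
    ≈⟨ ℚᵘ.≃-sym (ℚ.toℚᵘ-homo-* (ℤ.+ a ℚ./ 1) (ℤ.+ b ℚ./ 1)) ⟩
  toℚᵘ ((ℤ.+ a ℚ./ 1) ℚ.* (ℤ.+ b ℚ./ 1)) ∎)
  where open ℚᵘ.≃-Reasoning

0≤/1 : ∀ b → 0ℚ ℚ.≤ ℤ.+ b ℚ./ 1
0≤/1 b = ℚ.nonNegative⁻¹ (ℤ.+ b ℚ./ 1) {{ℚ.normalize-nonNeg b 1}}

/1-^-≤ : ∀ b n {q} → ℤ.+ b ℚ./ 1 ℚ.≤ q → ℤ.+ (b ^ n) ℚ./ 1 ℚ.≤ q ^ℚ n
/1-^-≤ b zero    b≤q = ℚ.≤-refl
/1-^-≤ b (suc n) {q} b≤q = begin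
  ℤ.+ (b * b ^ n) ℚ./ 1
    ≡⟨ /1-* b (b ^ n) ⟩
  (ℤ.+ b ℚ./ 1) ℚ.* (ℤ.+ (b ^ n) ℚ./ 1)
    ≤⟨ ℚ.*-monoʳ-≤-nonNeg (ℤ.+ (b ^ n) ℚ./ 1) {{ℚ.normalize-nonNeg (b ^ n) 1}} b≤q ⟩
  q ℚ.* (ℤ.+ (b ^ n) ℚ./ 1)
    ≤⟨ ℚ.*-monoˡ-≤-nonNeg q {{ℚ.nonNegative (ℚ.≤-trans (0≤/1 b) b≤q)}} (/1-^-≤ b n b≤q) ⟩
  q ℚ.* q ^ℚ n ∎
  where open ℚ.≤-Reasoning

-- A rational `q` not below `b` is non-negative with `q ^ n` at least `b ^ n`, hence at least `a`,
-- so it satisfies neither clause of the lower cut.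
root-≤ : ∀ n .{{_ : NonZero n}} a b → a ≤ b ^ n → root n a ≤ᴿ fromℕ b
root-≤ n a b a≤bⁿ q q∈root with q ℚ.<? ℤ.+ b ℚ./ 1 | q∈root
... | yes q<b | _         = q<b
... | no  q≮b | inj₁ q<0  = contradiction (ℚ.<-≤-trans q<0 (0≤/1 b)) q≮b
... | no  q≮b | inj₂ qⁿ<a = contradiction (ℚ.<-≤-trans qⁿ<a (ℚ.≤-trans
  (/-≤-/1 a (b ^ n) 1 (≤-trans a≤bⁿ (≤-reflexive (sym (*-identityʳ (b ^ n))))))
  (/1-^-≤ b n (ℚ.≮⇒≥ q≮b)))) (ℚ.<-irrefl refl)

-- The constants and the two limits.

linearConstant-≤ : ∀ l → linearConstant l ≤ 2 ^ (10 * suc l)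
linearConstant-≤ l = ^-monoʳ-≤ 2 (≤-trans (m≤m+n (logBlock l * 5) 5) (≤-reflexive (lemma l)))
  where
  lemma : ∀ l → suc (l + l) * 5 + 5 ≡ 10 * suc l
  lemma = solve-∀

-- With `k = suc l`, the factors contribute the exponents 4, 20 k and 1, and 20 k + 5 is at most 25
-- k. This is the source of the constant 25.
growthConstant-≤ : ∀ l → growthConstant l ≤ 2 ^ (25 * suc l)
growthConstant-≤ l = begin
  growthConstant l
    ≤⟨ *-monoʳ-≤ 16 (*-monoˡ-≤ 2 (*-mono-≤ (linearConstant-≤ l) (linearConstant-≤ l))) ⟩
  2 ^ 4 * (2 ^ e * 2 ^ e * 2 ^ 1)
    ≡⟨ cong (λ x → 2 ^ 4 * (x * 2 ^ 1)) (sym (^-distribˡ-+-* 2 e e)) ⟩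
  2 ^ 4 * (2 ^ (e + e) * 2 ^ 1)
    ≡⟨ cong (2 ^ 4 *_) (sym (^-distribˡ-+-* 2 (e + e) 1)) ⟩
  2 ^ 4 * 2 ^ (e + e + 1)
    ≡⟨ sym (^-distribˡ-+-* 2 4 (e + e + 1)) ⟩
  2 ^ (4 + (e + e + 1))
    ≤⟨ ^-monoʳ-≤ 2 (≤-trans (m≤m+n (4 + (e + e + 1)) (5 * l)) (≤-reflexive (lemma l))) ⟩
  2 ^ (25 * suc l) ∎
  where
  open ≤-Reasoning

  e : ℕ
  e = 10 * suc l

  lemma : ∀ l → 4 + (10 * suc l + 10 * suc l + 1) + 5 * l ≡ 25 * suc l
  lemma = solve-∀

FürediHajnalLimit-≤ : ∀ (π : Permutation′ (suc l)) c → IsFürediHajnalLimit π c →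
  c ≤ᴿ fromℕ (2 ^ (25 * suc l))
FürediHajnalLimit-≤ {l} π c c-limit = limit-≤ᴿ (λ n → fromℚ (ℤ.+ ex n π ℚ./ n)) c _ c-limit λ i →
  2 ^ i , m^n≢0 2 i , <⇒≤ (n<2^n i) ,
  λ q q<ex → ℚ.<-≤-trans q<ex (/-≤-/1 (ex (2 ^ i) π) E (2 ^ i) {{m^n≢0 2 i}}
    (≤-trans (ex-linear π i) (*-monoˡ-≤ (2 ^ i) D≤E)))
  where
  E : ℕ
  E = 2 ^ (25 * suc l)

  D≤E : linearConstant l ≤ E
  D≤E = ≤-trans (linearConstant-≤ l) (^-monoʳ-≤ 2 (*-monoˡ-≤ (suc l) (m≤m+n 10 15)))

StanleyWilfLimit-≤ : ∀ (π : Permutation′ (suc l)) L → IsStanleyWilfLimit π L →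
  L ≤ᴿ fromℕ (2 ^ (25 * suc l))
StanleyWilfLimit-≤ {l} π L L-limit = limit-≤ᴿ (λ n → root n (S n π)) L _ L-limit λ i →
  2 ^ i * D , side≢0 i , ≤-trans (<⇒≤ (n<2^n i)) (m≤m*n (2 ^ i) D) ,
  root-≤ (2 ^ i * D) {{side≢0 i}} (S (2 ^ i * D) π) (2 ^ (25 * suc l))
    (≤-trans (S-exponential π i) (^-monoˡ-≤ (2 ^ i * D) (growthConstant-≤ l)))
  where
  D : ℕ
  D = linearConstant l

  instance
    D≢0 : NonZero D
    D≢0 = m^n≢0 2 (logBlock l * 5)

  side≢0 : ∀ i → NonZero (2 ^ i * D)
  side≢0 i = m*n≢0 (2 ^ i) D {{m^n≢0 2 i}}

theorem3 : ∃[ C ] (0 < C × (∀ (k : ℕ) → 1 ≤ k → (π : Permutation′ k) →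
    (∀ (c : ℝ) → IsFürediHajnalLimit π c → c ≤ᴿ fromℕ (2 ^ (C * k))) ×
    (∀ (L : ℝ) → IsStanleyWilfLimit π L → L ≤ᴿ fromℕ (2 ^ (C * k)))))
theorem3 = 25 , z<s , λ { (suc l) _ π → FürediHajnalLimit-≤ π , StanleyWilfLimit-≤ π }
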